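{- Let $G$ be a planar factor-critical graph. Then the planar dual of $G$ is dual-critical, for every planar embedding of $G$.
   Context: Graphs are finite, undirected, with non-empty vertex set; parallel edges and loops are allowed. A graph is factor-critical if for every vertex $v$ the graph $G-v$ has a perfect matching (the empty graph counts as having a perfect matching, so a single vertex is factor-critical). An orientation of a graph is acyclic if it has no directed cycle (a directed loop counts as a directed cycle). A graph is dual-critical if it has an acyclic orientation in which all vertices except exactly one have odd indegree. The planar dual with respect to a planar embedding has one vertex for each face and one edge for each edge $e$ of $G$, joining the faces on the two sides of $e$ (a loop if they coincide). -}

module Defs where

open import Data.Bool using (Bool; true; false; not)
open import Data.Fin using (Fin; fromℕ<)
open import Data.Fin.Properties using (_≟_; any?; nonZeroIndex)
open import Data.Fin.Subset using (Subset; _∈_; _-_; ⊤)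
open import Data.List using (_∷_; _∷ʳ_; length; filter; allFin)
open import Data.List.Relation.Unary.Linked using (Linked)
open import Data.List.Relation.Unary.Unique.Propositional using (Unique)
open import Data.Nat using (ℕ; _+_; NonZero; >-nonZero⁻¹)
open import Data.Nat.Divisibility using (_∣_)
open import Data.Product using (_×_; _,_; ∃-syntax; ∃!)
open import Data.Unit using () renaming (⊤ to Unit)
open import Function using (_⇔_; _↔_; Inverse)
open import Relation.Binary.Construct.Closure.ReflexiveTransitive using (Star)
open import Relation.Binary.PropositionalEquality using (_≡_; _≢_)
open import Relation.Nullary using (¬_; yes; no)

------------------------------------------------------------------------
-- Graphs

-- Each edge e consists of two half-edges (darts) (e , true) and
-- (e , false), and `end e b` is the end vertex at which (e , b) sits.
-- Which half is called `true` carries no meaning.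

record Graph : Set where
  field
    #V #E        : ℕ
    {{nonempty}} : NonZero #V
    end          : Fin #E → Bool → Fin #V

  Vertex Edge Dart : Set
  Vertex = Fin #V
  Edge   = Fin #E
  Dart   = Edge × Bool

  reverse : Dart → Dart
  reverse (e , b) = e , not b

  -- A dart (e , b) is also read as e traversed away from `end e b`.

  origin target : Dart → Vertex
  origin (e , b) = end e b
  target d       = origin (reverse d)

  Incident : Vertex → Edge → Set
  Incident v e = ∃[ b ] end e b ≡ v

  Loop : Edge → Set
  Loop e = end e true ≡ end e false

  Adjacent : Vertex → Vertex → Set
  Adjacent u v = ∃[ d ] (origin d ≡ u × target d ≡ v)

  Isolated : Vertex → Set
  Isolated v = ∀ d → origin d ≢ v

open Graph

------------------------------------------------------------------------
-- Factor-critical graphs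

-- M is a perfect matching of the subgraph of G induced by S.

record IsPerfectMatchingOn (G : Graph) (S : Subset (#V G))
                           (M : Subset (#E G)) : Set where
  field
    inside   : ∀ {e} → e ∈ M → ∀ b → end G e b ∈ S
    loopless : ∀ {e} → e ∈ M → ¬ Loop G e
    covers   : ∀ {v} → v ∈ S → ∃! _≡_ (λ e → e ∈ M × Incident G v e)

FactorCritical : Graph → Set
FactorCritical G = ∀ v → ∃[ M ] IsPerfectMatchingOn G (⊤ - v) M

------------------------------------------------------------------------
-- Dual-critical graphs

module _ (G : Graph) where

  -- The edge e is directed from `end G e (ω e)` to its other end.

  Orientation : Set
  Orientation = Edge G → Bool

  module _ (ω : Orientation) where

    tail head : Edge G → Vertex G
    tail e = origin G (e , ω e)
    head e = target G (e , ω e)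

    Arc : Vertex G → Vertex G → Set
    Arc u v = ∃[ e ] (tail e ≡ u × head e ≡ v)

    -- A directed cycle through v, w₁, …, wₖ (all distinct) back to v;
    -- k = 0 is a directed loop.

    DirectedCycle : Set
    DirectedCycle = ∃[ v ] ∃[ ws ] (Unique (v ∷ ws) × Linked Arc (v ∷ ws ∷ʳ v))

    Acyclic : Set
    Acyclic = ¬ DirectedCycle

    indegree : Vertex G → ℕ
    indegree v = length (filter (λ e → head e ≟ v) (allFin (#E G)))

OddIndegree : (G : Graph) → Orientation G → Vertex G → Set
OddIndegree G ω v = ¬ (2 ∣ indegree G ω v)

DualCritical : Graph → Set
DualCritical G = ∃[ ω ] (Acyclic G ω ×
  ∃[ r ] (¬ OddIndegree G ω r × (∀ v → v ≢ r → OddIndegree G ω v)))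

------------------------------------------------------------------------
-- Planar embeddings

-- The labels in `Fin number` are the connected components of G.

record Components (G : Graph) : Set where
  field
    number     : ℕ
    component  : Vertex G → Fin number
    surjective : ∀ i → ∃[ v ] component v ≡ i
    correct    : ∀ u v → component u ≡ component v ⇔ Star (Adjacent G) u v

-- A rotation system together with faces.  `rotation` takes a dart to the
-- clockwise next one at the same vertex, so the boundary walk with its
-- face on the left continues after d with rotation (reverse d).  An
-- isolated vertex has no dart and is a boundary walk by itself; `around`
-- is its face.  In a disconnected graph one face may have several
-- boundary walks, so faces are labels constant along walks rather than
-- the walks themselves.

record Embedding (G : Graph) : Set where
  field
    rotation : Dart G ↔ Dart G

  next : Dart G → Dart G
  next = Inverse.to rotation

  field
    next-origin : ∀ d → origin G (next d) ≡ origin G d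
    next-cyclic : ∀ d d′ → origin G d ≡ origin G d′ →
                  Star (λ x y → next x ≡ y) d d′

    #F            : ℕ
    left          : Dart G → Fin #F
    around        : ∀ v → .(Isolated G v) → Fin #F
    left-boundary : ∀ d → left (next (reverse G d)) ≡ left d

  Face : Set
  Face = Fin #F

  data Touches : Vertex G → Face → Set where
    corner : ∀ d → Touches (origin G d) (left d)
    alone  : ∀ v (iso : Isolated G v) → Touches v (around v iso)

-- Why `euler` says that the surface is a sphere: let W be the number of
-- boundary walks, C of components, and g the sum of the genera of the
-- rotation systems of the components.  Then V - E + W = 2C - 2g.  The
-- bipartite graph on components and faces with one edge per boundary
-- walk is connected (`touched`, `connected`), so W ≥ C + F - 1.  Hence
-- V - E + F ≤ 1 + C - 2g, with equality iff that bipartite graph is a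
-- tree; so V - E + F = 1 + C iff g = 0 and it is a tree, i.e. the plane
-- drawings of the components are fitted together in a single sphere.
-- For connected G this is the usual V - E + F = 2, and the faces are
-- exactly the orbits of d ↦ rotation (reverse d).

record PlanarEmbedding (G : Graph) : Set where
  field
    embedding : Embedding G

  open Embedding embedding public

  field
    touched    : ∀ f → ∃[ v ] Touches v f
    connected  : ∀ u v → Star (λ x y → ∃[ f ] (Touches x f × Touches y f)) u v
    components : Components G
    euler      : #V G + #F ≡ #E G + (1 + Components.number components)

Planar : Graph → Set
Planar = PlanarEmbedding

------------------------------------------------------------------------
-- Planar duals

module _ {G : Graph} (P : PlanarEmbedding G) where
  open PlanarEmbedding P

  someFace : Face
  someFace with any? {n = #E G} {P = λ _ → Unit} (λ _ → yes _)
  ... | yes (e , _) = left (e , true)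
  ... | no  noEdge  = around (fromℕ< (>-nonZero⁻¹ (#V G)))
                             (λ (e , _) _ → noEdge (e , _))

  -- The dart (e , b) of the dual sits at the face on the left of e
  -- traversed from `end G e b`.

  dual : Graph
  dual = record
    { #V       = #F
    ; #E       = #E G
    ; nonempty = nonZeroIndex someFace
    ; end      = λ e b → left (e , b)
    }

{-# OPTIONS --safe #-}
module Submission where

-- A factor-critical graph has an odd ear decomposition (Lovász).  Each
-- ear lies on a circuit through earlier ears; adding these circuits up
-- with signs and rapidly growing scales gives a nowhere-zero integral
-- circulation φ whose signs on an ear are governed by the sign of its
-- own circuit.  On the sphere a multiple of φ is the coboundary of a
-- face potential, which increases along every arc of the dual oriented
-- by φ, so this orientation is acyclic for every choice of the signs.
-- Modulo 2, a set of faces whose boundary lies in the first i ears has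
-- either all or none of the i-th ear in its boundary; reversing that odd
-- ear therefore corrects the parity of the total indegree of all such
-- sets with the ear in their boundary at once.  The set of all faces
-- starts off with the right parity by Euler's formula, |V| being odd.

open import Defs
open import Algebra.Bundles using (CommutativeRing)
import Algebra.Properties.Semiring.Sum as Sum
open import Data.Bool using (Bool; true; false; not; _∧_; _∨_; _xor_; if_then_else_)
open import Data.Fin as Fin using (Fin; zero; suc; fromℕ<; splitAt; join; _↑ˡ_; _↑ʳ_; punchIn; punchOut)
open import Data.Fin.Properties using (+↔⊎; punchInᵢ≢i; punchIn-punchOut; punchIn-injective; splitAt-↑ˡ; splitAt-↑ʳ; join-splitAt; all?; any?; ¬∀⟶∃¬)
open import Data.Nat as ℕ using (ℕ; zero; suc; >-nonZero⁻¹)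
open import Data.Product using (_×_; _,_; proj₁; proj₂; ∃-syntax)
open import Data.Sum using (_⊎_; inj₁; inj₂; [_,_]′)
open import Function using (_∘_; id; _↔_; Inverse; Equivalence; mk↔ₛ′)
open import Function.Construct.Composition using (_↔-∘_)
open import Function.Construct.Symmetry using (↔-sym)
open import Level using (0ℓ)
open import Relation.Binary.PropositionalEquality as ≡ using (_≡_; _≢_)

open Graph

-- The obstacle is that faces cannot be corrected one by one: reversing a dual edge generally
-- disturbs two indegrees and may create a directed cycle. Parity is therefore demanded of sets of
-- faces. Those with boundary in the ears used so far form a space over F₂ that gains at most one
-- dimension per ear, and each ear offers exactly one binary choice, the sign of its circuit. The
-- embedding enters algebraically. Coboundaries of face functions are orthogonal to coboundaries of
-- vertex functions over every commutative ring. Over F₂ this makes the boundary of a set of faces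
-- even at every vertex; over ℤ, Euler's formula turns it by a dimension count into the existence of
-- a face potential for each circulation.

darts : (G : Graph) → Fin (#E G ℕ.+ #E G) ↔ Dart G
darts G = side ↔-∘ +↔⊎
  where
  side : (Edge G ⊎ Edge G) ↔ Dart G
  side = mk↔ₛ′ [ (_, true) , (_, false) ]′
               (λ { (e , true) → inj₁ e ; (e , false) → inj₂ e })
               (λ { (_ , true) → ≡.refl ; (_ , false) → ≡.refl })
               (λ { (inj₁ _) → ≡.refl ; (inj₂ _) → ≡.refl })

reverse-involutive : (G : Graph) → ∀ d → reverse G (reverse G d) ≡ d
reverse-involutive G (_ , true)  = ≡.refl
reverse-involutive G (_ , false) = ≡.refl

reversal : (G : Graph) → Dart G ↔ Dart G
reversal G = mk↔ₛ′ (reverse G) (reverse G) (reverse-involutive G) (reverse-involutive G)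

-- Finite sums, coboundaries and circulations over a commutative ring

module Chains (R : CommutativeRing 0ℓ 0ℓ) where
  open CommutativeRing R
  open Sum semiring public
  open import Relation.Binary.Reasoning.Setoid setoid
  open import Algebra.Properties.Ring ring using (+-cancelʳ; x[y-z]≈xy-xz; [y-z]x≈yx-zx)
  open import Algebra.Properties.AbelianGroup +-abelianGroup using (⁻¹-anti-homo‿-)
  open import Algebra.Solver.CommutativeMonoid +-commutativeMonoid using (solve; _⊜_; _⊕_)

  sum-zero : ∀ {n} {f : Fin n → Carrier} → (∀ i → f i ≈ 0#) → sum f ≈ 0#
  sum-zero {n} f≈0 = trans (sum-cong-≋ f≈0) (sum-replicate-zero n)

  sum-single : ∀ {n} (i : Fin n) {f : Fin n → Carrier} →
               (∀ j → j ≢ i → f j ≈ 0#) → sum f ≈ f i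
  sum-single {suc n} i {f} rest = begin
    sum f                            ≈⟨ sum-remove {i = i} f ⟩
    f i + sum (λ k → f (punchIn i k)) ≈⟨ +-congˡ (sum-zero λ k → rest _ (punchInᵢ≢i i k)) ⟩
    f i + 0#                         ≈⟨ +-identityʳ _ ⟩
    f i                              ∎

  sum-pair : ∀ {n} {i j : Fin n} {f : Fin n → Carrier} → i ≢ j →
             (∀ k → k ≢ i → k ≢ j → f k ≈ 0#) → sum f ≈ f i + f j
  sum-pair {suc n} {i} {j} {f} i≢j rest = begin
    sum f                             ≈⟨ sum-remove {i = i} f ⟩
    f i + sum (λ k → f (punchIn i k)) ≈⟨ +-congˡ (sum-single (punchOut i≢j) others) ⟩
    f i + f (punchIn i (punchOut i≢j)) ≡⟨ ≡.cong (λ k → f i + f k) (punchIn-punchOut i≢j) ⟩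
    f i + f j                         ∎
    where
    others : ∀ k → k ≢ punchOut i≢j → f (punchIn i k) ≈ 0#
    others k k≢ = rest _ (punchInᵢ≢i i k) λ eq →
      k≢ (punchIn-injective i _ _ (≡.trans eq (≡.sym (punchIn-punchOut i≢j))))

  sum-split : ∀ m {n} (f : Fin (m ℕ.+ n) → Carrier) →
              sum f ≈ sum (λ i → f (i ↑ˡ n)) + sum (λ j → f (m ↑ʳ j))
  sum-split zero    f = sym (+-identityˡ _)
  sum-split (suc m) f = trans (+-congˡ (sum-split m (f ∘ suc))) (sym (+-assoc _ _ _))

  δ : (G : Graph) → (Vertex G → Carrier) → Edge G → Carrier
  δ G g e = g (end G e true) - g (end G e false)

  -- Conservation at all vertices, in dual form: taking `g` to be the indicator of a vertex gives
  -- the net outflow there.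
  IsCirculation : (G : Graph) → (Edge G → Carrier) → Set
  IsCirculation G z = ∀ g → sum (λ e → z e * δ G g e) ≈ 0#

  module _ (G : Graph) where

    dartSum : (Dart G → Carrier) → Carrier
    dartSum F = sum λ e → F (e , true) + F (e , false)

    dartSum-flat : ∀ F → dartSum F ≈ sum (F ∘ Inverse.to (darts G))
    dartSum-flat F = begin
      dartSum F ≈⟨ ∑-distrib-+ {#E G} _ _ ⟩
      sum (λ e → F (e , true)) + sum (λ e → F (e , false))
        ≡⟨ ≡.cong₂ _+_ (sum-cong-≗ λ e → ≡.cong (F ∘ label) (≡.sym (splitAt-↑ˡ (#E G) e (#E G))))
                       (sum-cong-≗ λ e → ≡.cong (F ∘ label) (≡.sym (splitAt-↑ʳ (#E G) (#E G) e))) ⟩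
      _ ≈⟨ sum-split (#E G) (F ∘ Inverse.to (darts G)) ⟨
      sum (F ∘ Inverse.to (darts G)) ∎
      where
      label : Edge G ⊎ Edge G → Dart G
      label = [ (_, true) , (_, false) ]′

    dartSum-permute : ∀ F (π : Dart G ↔ Dart G) → dartSum F ≈ dartSum (F ∘ Inverse.to π)
    dartSum-permute F π = begin
      dartSum F                          ≈⟨ dartSum-flat F ⟩
      sum (F ∘ Inverse.to (darts G))     ≈⟨ sum-permute (F ∘ to) (↔-sym (darts G) ↔-∘ (π ↔-∘ darts G)) ⟩
      sum (F ∘ to ∘ Inverse.from (darts G) ∘ Inverse.to π ∘ to)
        ≡⟨ sum-cong-≗ {#E G ℕ.+ #E G} (λ i → ≡.cong F (Inverse.strictlyInverseˡ (darts G) (Inverse.to π (to i)))) ⟩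
      sum (F ∘ Inverse.to π ∘ to)        ≈⟨ dartSum-flat (F ∘ Inverse.to π) ⟨
      dartSum (F ∘ Inverse.to π)         ∎
      where to = Inverse.to (darts G)

  -- The product of differences expands to `along` minus `across`, summed over both darts of an
  -- edge. The permutation `next` after `reverse` follows the face walks: it keeps the left face and
  -- moves the origin to the target, so it carries one sum into the other.
  δ-dual-circulation : ∀ {G} (P : PlanarEmbedding G) h → IsCirculation G (δ (dual P) h)
  δ-dual-circulation {G} P h g = +-cancelʳ (dartSum G across) _ _ (begin
    sum (λ e → δ (dual P) h e * δ G g e) + dartSum G across
      ≈⟨ ∑-distrib-+ {#E G} _ _ ⟨
    sum (λ e → δ (dual P) h e * δ G g e + (across (e , true) + across (e , false)))
      ≈⟨ sum-cong-≋ (λ e → expand (h (left (e , true))) (h (left (e , false))) (g (end G e true)) (g (end G e false))) ⟩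
    dartSum G along
      ≈⟨ dartSum-permute G along (rotation ↔-∘ reversal G) ⟩
    dartSum G (λ d → along (next (reverse G d)))
      ≡⟨ sum-cong-≗ (λ e → ≡.cong₂ _+_ (turn (e , true)) (turn (e , false))) ⟩
    dartSum G across
      ≈⟨ +-identityˡ _ ⟨
    0# + dartSum G across ∎)
    where
    open PlanarEmbedding P
    along across : Dart G → Carrier
    along  d = h (left d) * g (origin G d)
    across d = h (left d) * g (target G d)
    turn : ∀ d → along (next (reverse G d)) ≡ across d
    turn d = ≡.cong₂ (λ f v → h f * g v) (left-boundary d) (next-origin (reverse G d))
    expand : ∀ a b c d → (a - b) * (c - d) + (a * d + b * c) ≈ a * c + b * d
    expand a b c d = begin
      (a - b) * (c - d) + (a * d + b * c)
        ≈⟨ +-congʳ (trans (x[y-z]≈xy-xz (a - b) c d) (+-cong ([y-z]x≈yx-zx c a b) (-‿cong ([y-z]x≈yx-zx d a b)))) ⟩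
      (a * c - b * c) - (a * d - b * d) + (a * d + b * c)
        ≈⟨ +-congʳ (+-congˡ (⁻¹-anti-homo‿- (a * d) (b * d))) ⟩
      (a * c - b * c) + (b * d - a * d) + (a * d + b * c)
        ≈⟨ solve 6 (λ p q q⁻ r r⁻ s → ((p ⊕ q⁻) ⊕ (s ⊕ r⁻)) ⊕ (r ⊕ q) ⊜ (p ⊕ s) ⊕ ((q ⊕ q⁻) ⊕ (r ⊕ r⁻)))
                   refl (a * c) (b * c) (- (b * c)) (a * d) (- (a * d)) (b * d) ⟩
      (a * c + b * d) + ((b * c - b * c) + (a * d - a * d))
        ≈⟨ +-congˡ (+-cong (-‿inverseʳ _) (-‿inverseʳ _)) ⟩
      (a * c + b * d) + (0# + 0#)
        ≈⟨ trans (+-congˡ (+-identityˡ 0#)) (+-identityʳ _) ⟩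
      a * c + b * d ∎

import Data.Bool.Properties as Bool
open import Data.Fin.Subset using (Subset; _∈_; _∉_; ⊤; ⊥; ⁅_⁆; _∪_; _⊃_) renaming (_-_ to _∖_)
open import Data.Fin.Subset.Induction using (⊃-wellFounded; Acc; acc)
open import Data.Fin.Subset.Properties using (_∈?_; anySubset?; ∈⊤; ∉⊥; ⊆⊤; ⊆-antisym; p⊆p∪q; q⊆p∪q; x∈p∪q⁻; x∈p∧x≢y⇒x∈p-y; x∈⁅x⁆; x∈⁅y⁆⇒x≡y; x≢y⇒x∉⁅y⁆)
open import Data.Integer using (ℤ; +_; -[1+_]; 0ℤ; 1ℤ; -1ℤ; _+_; _*_; -_; _-_; ∣_∣; _≤_; _<_; -≤+; +≤+; +<+)
open import Data.Integer.Properties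
open import Data.Integer.Tactic.RingSolver using (solve-∀)
open import Data.List using (_∷_; []; _∷ʳ_; length; filter) renaming (tabulate to tabulateᴸ)
open import Data.List.Relation.Unary.Linked using (Linked; [-]; _∷_)
open import Data.Nat.Divisibility using (_∣_; divides; ∣-refl; ∣m∣n⇒∣m+n)
import Data.Nat.Properties as ℕ
open import Data.Vec using (_∷_; lookup; tabulate; there)
open import Data.Vec.Properties using ([]=⇒lookup; lookup⇒[]=; lookup-zipWith; lookup∘tabulate)
import Data.Vec.Functional as F
open import Relation.Binary.Construct.Closure.ReflexiveTransitive using (Star; ε; _◅_)
open import Relation.Binary.PropositionalEquality
open import Relation.Nullary using (¬_; Dec; yes; no; does; contradiction; ¬?)
open import Relation.Nullary.Decidable using (dec-true; dec-false; decidable-stable; _×-dec_; _→-dec_; _⊎-dec_)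
open import Relation.Unary using (Decidable)

open ≡-Reasoning

-- Parities as sums over F₂

module F₂ = Chains Bool.xor-∧-commutativeRing

parity : ℕ → Bool
parity n = F₂.sum {n} (λ _ → true)

parity-+ : ∀ m n → parity (m ℕ.+ n) ≡ parity m xor parity n
parity-+ m n = F₂.sum-split m {n} (λ _ → true)

parity≡false⇒even : ∀ n → parity n ≡ false → 2 ∣ n
parity≡false⇒even zero          _  = divides 0 refl
parity≡false⇒even (suc (suc n)) eq =
  ∣m∣n⇒∣m+n ∣-refl (parity≡false⇒even n (trans (Bool.xor-assoc true true (parity n)) eq))

even⇒parity≡false : ∀ {n} → 2 ∣ n → parity n ≡ false
even⇒parity≡false (divides q refl) = twice q
  where
  twice : ∀ q → parity (q ℕ.* 2) ≡ false
  twice zero    = refl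
  twice (suc q) = trans (sym (Bool.xor-assoc true true (parity (q ℕ.* 2)))) (twice q)

parity-filter : ∀ {A : Set} {P : A → Set} (P? : Decidable P) {n} (f : Fin n → A) →
                parity (length (filter P? (tabulateᴸ f))) ≡ F₂.sum (λ i → does (P? (f i)))
parity-filter P? {zero}  f = refl
parity-filter P? {suc n} f with does (P? (f zero))
... | true  = cong (true xor_) (parity-filter P? (f ∘ suc))
... | false = parity-filter P? (f ∘ suc)

∉⇒lookup : ∀ {n} {p : Subset n} {x} → x ∉ p → lookup p x ≡ false
∉⇒lookup {p = p} {x} x∉p = Bool.¬-not λ eq → x∉p (lookup⇒[]= x p eq)

x∉p∖x : ∀ {n} (p : Subset n) x → x ∉ p ∖ x
x∉p∖x (_ ∷ p) (suc x) (there x∈) = x∉p∖x p x x∈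

someVertex : (G : Graph) → Vertex G
someVertex G = fromℕ< (>-nonZero⁻¹ (#V G))

indicator : ∀ {n} → Fin n → Fin n → Bool
indicator i j = does (i Fin.≟ j)

sum-indicator : ∀ {n} (f : Fin n → Bool) i → F₂.sum (λ j → f j ∧ indicator i j) ≡ f i
sum-indicator f i = trans (F₂.sum-single i λ j j≢i → trans (cong (f j ∧_) (dec-false (i Fin.≟ j) (j≢i ∘ sym))) (Bool.∧-zeroʳ (f j)))
                          (trans (cong (f i ∧_) (dec-true (i Fin.≟ i) refl)) (Bool.∧-identityʳ (f i)))

-- Perfect matchings modulo 2 and the connectedness of factor-critical graphs

module _ {G : Graph} {r} {M} (isM : IsPerfectMatchingOn G (⊤ ∖ r) M) where
  open IsPerfectMatchingOn isM

  matching-degree : ∀ v → F₂.sum (λ e → lookup M e ∧ F₂.δ G (λ u → indicator u v) e) ≡ not (indicator r v)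
  matching-degree v with r Fin.≟ v
  ... | yes refl = F₂.sum-zero misses
    where
    misses : ∀ e → lookup M e ∧ F₂.δ G (λ u → indicator u r) e ≡ false
    misses e with lookup M e in eq
    ... | false = refl
    ... | true  = cong₂ _xor_ (avoids true) (avoids false)
      where
      avoids : ∀ b → indicator (end G e b) r ≡ false
      avoids b = dec-false (end G e b Fin.≟ r) λ { refl → x∉p∖x ⊤ r (inside (lookup⇒[]= e M eq) b) }
  ... | no r≢v with covers (x∈p∧x≢y⇒x∈p-y ∈⊤ (r≢v ∘ sym))
  ... | e , (e∈M , (b , refl)) , unique = trans (F₂.sum-single e others) (cong₂ _∧_ ([]=⇒lookup e∈M) (once b))
    where
    others : ∀ k → k ≢ e → lookup M k ∧ F₂.δ G (λ u → indicator u (end G e b)) k ≡ false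
    others k k≢e with lookup M k in eq
    ... | false = refl
    ... | true  = cong₂ _xor_ (avoids true) (avoids false)
      where
      avoids : ∀ b′ → indicator (end G k b′) (end G e b) ≡ false
      avoids b′ = dec-false (end G k b′ Fin.≟ end G e b) λ eq′ → k≢e (sym (unique (lookup⇒[]= k M eq , b′ , eq′)))
    once : ∀ b → F₂.δ G (λ u → indicator u (end G e b)) e ≡ true
    once true  = cong₂ _xor_ (dec-true (end G e true Fin.≟ end G e true) refl) (dec-false (end G e false Fin.≟ end G e true) (loopless e∈M ∘ sym))
    once false = cong₂ _xor_ (dec-false (end G e true Fin.≟ end G e false) (loopless e∈M)) (dec-true (end G e false Fin.≟ end G e false) refl)

  -- Over F₂ a difference is a sum, so the right side adds `g` over the ends of the matching edges,
  -- which are the vertices other than `r`, each once. Formally, `δ g` is expanded in vertex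
  -- indicators and the two sums are exchanged.
  matching-sum : ∀ g → F₂.sum g xor g r ≡ F₂.sum (λ e → lookup M e ∧ F₂.δ G g e)
  matching-sum g = sym (begin
    F₂.sum (λ e → lookup M e ∧ F₂.δ G g e)
      ≡⟨ F₂.sum-cong-≗ {#E G} (λ e → trans (cong (lookup M e ∧_) (expand e)) (F₂.*-distribˡ-sum {#V G} (lookup M e) _)) ⟩
    F₂.sum (λ e → F₂.sum (λ v → lookup M e ∧ (g v ∧ ι v e)))
      ≡⟨ F₂.∑-comm {#E G} {#V G} _ ⟩
    F₂.sum (λ v → F₂.sum (λ e → lookup M e ∧ (g v ∧ ι v e)))
      ≡⟨ F₂.sum-cong-≗ {#V G} column ⟩
    F₂.sum (λ v → g v xor (g v ∧ indicator r v))
      ≡⟨ F₂.∑-distrib-+ {#V G} g _ ⟩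
    F₂.sum g xor F₂.sum (λ v → g v ∧ indicator r v)
      ≡⟨ cong (F₂.sum g xor_) (sum-indicator g r) ⟩
    F₂.sum g xor g r ∎)
    where
    ι : Vertex G → Edge G → Bool
    ι v = F₂.δ G (λ u → indicator u v)

    expand : ∀ e → F₂.δ G g e ≡ F₂.sum (λ v → g v ∧ ι v e)
    expand e = sym (trans (F₂.sum-cong-≗ {#V G} λ v → Bool.∧-distribˡ-xor (g v) (indicator (end G e true) v) (indicator (end G e false) v))
              (trans (F₂.∑-distrib-+ {#V G} _ _) (cong₂ _xor_ (sum-indicator g (end G e true)) (sum-indicator g (end G e false)))))

    column : ∀ v → F₂.sum (λ e → lookup M e ∧ (g v ∧ ι v e)) ≡ g v xor (g v ∧ indicator r v)
    column v = begin
      F₂.sum (λ e → lookup M e ∧ (g v ∧ ι v e))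
        ≡⟨ F₂.sum-cong-≗ {#E G} (λ e → swap (lookup M e) (g v) (ι v e)) ⟩
      F₂.sum (λ e → g v ∧ (lookup M e ∧ ι v e))
        ≡⟨ F₂.*-distribˡ-sum {#E G} (g v) _ ⟨
      g v ∧ F₂.sum (λ e → lookup M e ∧ ι v e)
        ≡⟨ cong (g v ∧_) (matching-degree v) ⟩
      g v ∧ not (indicator r v)
        ≡⟨ split (g v) (indicator r v) ⟩
      g v xor (g v ∧ indicator r v) ∎
      where
      swap : ∀ a b c → a ∧ (b ∧ c) ≡ b ∧ (a ∧ c)
      swap a b c = trans (sym (Bool.∧-assoc a b c)) (trans (cong (_∧ c) (Bool.∧-comm a b)) (Bool.∧-assoc b a c))
      split : ∀ a b → a ∧ not b ≡ a xor (a ∧ b)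
      split false b = refl
      split true  b = refl

xor≡false⇒≡ : ∀ {a b} → a xor b ≡ false → a ≡ b
xor≡false⇒≡ {true}  {true}  _ = refl
xor≡false⇒≡ {false} {false} _ = refl

module _ {G : Graph} (fc : FactorCritical G) where

  -- The matching that misses `v` pairs off the other vertices with equal values, which cancel. As
  -- the total does not depend on `v`, this yields connectedness as well as odd order.
  locally-constant-sum : ∀ (g : Vertex G → Bool) → (∀ e → F₂.δ G g e ≡ false) → ∀ v → F₂.sum g ≡ g v
  locally-constant-sum g δg≡0 v = xor≡false⇒≡ (trans (matching-sum (proj₂ (fc v)) g)
    (F₂.sum-zero λ e → trans (cong (lookup (proj₁ (fc v)) e ∧_) (δg≡0 e)) (Bool.∧-zeroʳ _)))

  odd-order : parity (#V G) ≡ true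
  odd-order = locally-constant-sum (λ _ → true) (λ _ → refl) (someVertex G)

  locally-constant⇒constant : ∀ (g : Vertex G → Bool) → (∀ e → F₂.δ G g e ≡ false) → ∀ u v → g u ≡ g v
  locally-constant⇒constant g δg≡0 u v =
    trans (sym (locally-constant-sum g δg≡0 u)) (locally-constant-sum g δg≡0 v)

  single-component : (C : Components G) → Components.number C ≡ 1
  single-component C = unique number (component (someVertex G)) λ i →
    let v , eq = surjective i in trans (same (someVertex G) v) eq
    where
    open Components C
    unique : ∀ n (i : Fin n) → (∀ j → i ≡ j) → n ≡ 1
    unique (suc zero)    _ _   = refl
    unique (suc (suc n)) i all = contradiction (trans (sym (all zero)) (all (suc zero))) λ ()

    inSame : Vertex G → Vertex G → Bool
    inSame u v = indicator (component u) (component v)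

    adjacent : ∀ e → component (end G e true) ≡ component (end G e false)
    adjacent e = Equivalence.from (correct _ _) (((e , true) , refl , refl) ◅ ε)

    same : ∀ u v → component u ≡ component v
    same u v with component u Fin.≟ component v | locally-constant⇒constant (inSame u)
        (λ e → trans (cong (λ c → indicator (component u) c xor inSame u (end G e false)) (adjacent e)) (Bool.xor-same (inSame u (end G e false)))) u v
    ... | yes eq | _  = eq
    ... | no _   | eq = contradiction (trans (sym eq) (dec-true (component u Fin.≟ component u) refl)) λ ()

  euler-connected : (P : PlanarEmbedding G) → #V G ℕ.+ PlanarEmbedding.#F P ≡ #E G ℕ.+ 2
  euler-connected P = trans euler (cong (λ n → #E G ℕ.+ (1 ℕ.+ n)) (single-component components))
    where open PlanarEmbedding P

  face-parity : (P : PlanarEmbedding G) → parity (#E G) ≡ not (parity (PlanarEmbedding.#F P))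
  face-parity P = begin
    parity (#E G)                       ≡⟨ Bool.xor-identityʳ _ ⟨
    parity (#E G) xor false             ≡⟨ parity-+ (#E G) 2 ⟨
    parity (#E G ℕ.+ 2)                 ≡⟨ cong parity (euler-connected P) ⟨
    parity (#V G ℕ.+ #F)                ≡⟨ parity-+ (#V G) #F ⟩
    parity (#V G) xor parity #F         ≡⟨ cong (_xor parity #F) odd-order ⟩
    not (parity #F)                     ∎
    where open PlanarEmbedding P

-- Connectedness of the dual

module _ {G : Graph} (P : PlanarEmbedding G) where
  open PlanarEmbedding P

  -- Consecutive faces around a vertex are separated by an edge, so `h` is constant around each
  -- vertex; `connected` passes the value on between vertices that touch a common face.
  dual-connected : ∀ {A : Set} (h : Face → A) → (∀ e → h (left (e , true)) ≡ h (left (e , false))) →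
                   ∀ f f′ → h f ≡ h f′
  dual-connected h level f f′ =
    let v , tf  = touched f
        w , tf′ = touched f′
    in go (connected v w) tf tf′
    where
    across : ∀ d → h (left (reverse G d)) ≡ h (left d)
    across (e , true)  = sym (level e)
    across (e , false) = level e

    turn : ∀ d → h (left (next d)) ≡ h (left d)
    turn d = trans (cong h (trans (cong (left ∘ next) (sym (reverse-involutive G d))) (left-boundary (reverse G d)))) (across d)

    turns : ∀ {d d′} → Star (λ x y → next x ≡ y) d d′ → h (left d) ≡ h (left d′)
    turns ε             = refl
    turns (refl ◅ path) = trans (sym (turn _)) (turns path)

    at : ∀ {v f f′} → Touches v f → Touches v f′ → h f ≡ h f′
    at t t′ = at′ t t′ refl
      where
      -- Two vertices and an equation between them: with a shared index, matching on two corners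
      -- would have to unify `origin` terms.
      at′ : ∀ {v v′ f f′} → Touches v f → Touches v′ f′ → v ≡ v′ → h f ≡ h f′
      at′ (corner d)    (corner d′)    eq   = turns (next-cyclic d d′ eq)
      at′ (corner d)    (alone v iso)  eq   = contradiction eq (iso d)
      at′ (alone v iso) (corner d)     eq   = contradiction (sym eq) (iso d)
      at′ (alone v iso) (alone _ iso′) refl = refl

    go : ∀ {v w f f′} → Star (λ x y → ∃[ f ] (Touches x f × Touches y f)) v w →
         Touches v f → Touches w f′ → h f ≡ h f′
    go ε                    t t′ = at t t′
    go ((_ , t₁ , t₂) ◅ path) t t′ = trans (at t t₁) (go path t₂ t′)

-- Integral linear systems

module ℤ-Chains = Chains +-*-commutativeRing

-- The combination enters as a function `z` that agrees with it pointwise, since functions with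
-- equal values need not be equal terms.
IsLinear : ∀ {m} → ((Fin m → ℤ) → ℤ) → Set
IsLinear L = ∀ a b x y z → (∀ j → z j ≡ a * x j + b * y j) → L z ≡ a * L x + b * L y

module _ {m} {L L′ : (Fin m → ℤ) → ℤ} (lin : IsLinear L) (lin′ : IsLinear L′) where

  +-linear : IsLinear (λ x → L x + L′ x)
  +-linear a b x y z eq = trans (cong₂ _+_ (lin a b x y z eq) (lin′ a b x y z eq)) (regroup a b (L x) (L y) (L′ x) (L′ y))
    where
    regroup : ∀ a b p q r s → (a * p + b * q) + (a * r + b * s) ≡ a * (p + r) + b * (q + s)
    regroup = solve-∀

  minus-linear : IsLinear (λ x → L x - L′ x)
  minus-linear a b x y z eq = trans (cong₂ _-_ (lin a b x y z eq) (lin′ a b x y z eq)) (regroup a b (L x) (L y) (L′ x) (L′ y))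
    where
    regroup : ∀ a b p q r s → (a * p + b * q) - (a * r + b * s) ≡ a * (p - r) + b * (q - s)
    regroup = solve-∀

scale-linear : ∀ {m} {L : (Fin m → ℤ) → ℤ} c → IsLinear L → IsLinear (λ x → c * L x)
scale-linear {L = L} c lin a b x y z eq = trans (cong (c *_) (lin a b x y z eq)) (regroup a b c (L x) (L y))
  where
  regroup : ∀ a b c p q → c * (a * p + b * q) ≡ a * (c * p) + b * (c * q)
  regroup = solve-∀

Solution : ∀ {n m} → (Fin n → (Fin m → ℤ) → ℤ) → Set
Solution L = ∃[ x ] ((∃[ j ] x j ≢ 0ℤ) × (∀ i → L i x ≡ 0ℤ))

unit : ∀ {m} → Fin (suc m) → ℤ
unit = 1ℤ F.∷ λ _ → 0ℤ

lift : ∀ {m} → (Fin m → ℤ) → Fin (suc m) → ℤ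
lift x = 0ℤ F.∷ x

lift-linear : ∀ {m} {M : (Fin (suc m) → ℤ) → ℤ} → IsLinear M → IsLinear (M ∘ lift)
lift-linear lin a b x y z eq = lin a b (lift x) (lift y) (lift z) λ where
  zero    → sym (cong₂ _+_ (*-zeroʳ a) (*-zeroʳ b))
  (suc j) → eq j

module Elimination {n m} (L : Fin (suc n) → (Fin (suc m) → ℤ) → ℤ) (lin : ∀ i → IsLinear (L i))
                   (i : Fin (suc n)) (p≢0 : L i unit ≢ 0ℤ) where

  -- Gaussian elimination of the first unknown with pivot `L i unit`, by cross-multiplication
  -- because ℤ has no division.
  reduced : Fin n → (Fin m → ℤ) → ℤ
  reduced k x = L i unit * L (punchIn i k) (lift x) - L (punchIn i k) unit * L i (lift x)

  reduced-linear : ∀ k → IsLinear (reduced k)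
  reduced-linear k = minus-linear (scale-linear (L i unit) (lift-linear (lin (punchIn i k))))
                                  (scale-linear (L (punchIn i k) unit) (lift-linear (lin i)))

  module _ (x : Fin m → ℤ) where

    -- Scaling the old unknowns by the pivot lets equation `i` be solved integrally for the first
    -- unknown; the other equations then become the reduced ones.
    extend : Fin (suc m) → ℤ
    extend = (- L i (lift x)) F.∷ λ k → L i unit * x k

    L-extend : ∀ k → L k extend ≡ L i unit * L k (lift x) - L k unit * L i (lift x)
    L-extend k = trans (lin k (- L i (lift x)) (L i unit) unit (lift x) extend λ where
        zero    → sym (trans (cong₂ _+_ (*-identityʳ (- L i (lift x))) (*-zeroʳ (L i unit))) (+-identityʳ (- L i (lift x))))
        (suc j) → sym (trans (cong (_+ L i unit * x j) (*-zeroʳ (- L i (lift x)))) (+-identityˡ (L i unit * x j))))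
      (swap (L i (lift x)) (L k unit) (L i unit * L k (lift x)))
      where
      swap : ∀ u q s → - u * q + s ≡ s - q * u
      swap = solve-∀

  extend-solution : Solution reduced → Solution L
  extend-solution (x , (j , xj≢0) , solves) =
    extend x , (suc j , λ eq → [ p≢0 , xj≢0 ]′ (i*j≡0⇒i≡0∨j≡0 (L i unit) eq)) , solves′
    where
    solves′ : ∀ k → L k (extend x) ≡ 0ℤ
    solves′ k with i Fin.≟ k
    ... | yes refl = trans (L-extend x i) (+-inverseʳ (L i unit * L i (lift x)))
    ... | no  i≢k  = subst (λ k → L k (extend x) ≡ 0ℤ) (punchIn-punchOut i≢k)
                       (trans (L-extend x _) (solves (punchOut i≢k)))

nontrivial-solution : ∀ {n m} → n ℕ.< m → (L : Fin n → (Fin m → ℤ) → ℤ) →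
                      (∀ i → IsLinear (L i)) → Solution L
nontrivial-solution {zero}  {suc m} _           L lin = (λ _ → 1ℤ) , (zero , λ ()) , λ ()
nontrivial-solution {suc n} {suc m} (ℕ.s≤s n<m) L lin with all? (λ i → L i unit ≟ 0ℤ)
... | yes vanish = unit , (zero , λ ()) , vanish
... | no  ¬vanish =
  let i , p≢0 = ¬∀⟶∃¬ (suc n) _ (λ i → L i unit ≟ 0ℤ) ¬vanish
      open Elimination L lin i p≢0
  in extend-solution (nontrivial-solution n<m reduced reduced-linear)

nonneg-sum : ∀ {n} {f : Fin n → ℤ} → (∀ i → 0ℤ ≤ f i) → 0ℤ ≤ ℤ-Chains.sum f
nonneg-sum {zero}  f≥0 = +≤+ ℕ.z≤n
nonneg-sum {suc n} f≥0 = +-mono-≤ (f≥0 zero) (nonneg-sum (f≥0 ∘ suc))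

term≤sum : ∀ {n} {f : Fin n → ℤ} → (∀ i → 0ℤ ≤ f i) → ∀ i → f i ≤ ℤ-Chains.sum f
term≤sum {suc n} {f} f≥0 zero    = subst (_≤ f zero + ℤ-Chains.sum (f ∘ suc)) (+-identityʳ (f zero)) (+-monoʳ-≤ (f zero) (nonneg-sum (f≥0 ∘ suc)))
term≤sum {suc n} {f} f≥0 (suc i) = ≤-trans (term≤sum (f≥0 ∘ suc) i)
  (subst (_≤ f zero + ℤ-Chains.sum (f ∘ suc)) (+-identityˡ _) (+-monoˡ-≤ (ℤ-Chains.sum (f ∘ suc)) (f≥0 zero)))

0≤i*i : ∀ i → 0ℤ ≤ i * i
0≤i*i (+ n)         = subst (0ℤ ≤_) (pos-* n n) (+≤+ ℕ.z≤n)
0≤i*i (ℤ.negsuc n)  = +≤+ ℕ.z≤n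

-- Here the order of ℤ is essential: over F₂ a nonzero vector can be orthogonal to itself.
sum-squares≡0 : ∀ {n} (f : Fin n → ℤ) → ℤ-Chains.sum (λ i → f i * f i) ≡ 0ℤ → ∀ i → f i ≡ 0ℤ
sum-squares≡0 f eq i = [ (λ z → z) , (λ z → z) ]′ (i*j≡0⇒i≡0∨j≡0 (f i)
  (≤-antisym (subst (f i * f i ≤_) eq (term≤sum (λ j → 0≤i*i (f j)) i)) (0≤i*i (f i))))

-- Circulations are face potentials

module _ {G : Graph} (fc : FactorCritical G) (P : PlanarEmbedding G) where
  open PlanarEmbedding P
  open ℤ-Chains using (sum; δ)

  module Potential (φ : Edge G → ℤ) (circ : ℤ-Chains.IsCirculation G φ)
           (h : Face → ℤ) (g : Vertex G → ℤ) (t : ℤ)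
           (solves : ∀ e → δ (dual P) h e + δ G g e + t * φ e ≡ 0ℤ) where

    gradient-orthogonal : sum (λ e → δ G g e * δ G g e) ≡ 0ℤ
    gradient-orthogonal = begin
      sum (λ e → δ G g e * δ G g e)
        ≡⟨ trans (sym (+-identityˡ _)) (sym (+-identityʳ _)) ⟩
      0ℤ + sum (λ e → δ G g e * δ G g e) + 0ℤ
        ≡⟨ cong₂ (λ u v → u + sum (λ e → δ G g e * δ G g e) + v)
             (ℤ-Chains.δ-dual-circulation P h g) (trans (cong (t *_) (circ g)) (*-zeroʳ t)) ⟨
      sum (λ e → δ (dual P) h e * δ G g e) + sum (λ e → δ G g e * δ G g e) + t * sum (λ e → φ e * δ G g e)
        ≡⟨ cong₂ _+_ (ℤ-Chains.∑-distrib-+ {#E G} _ _) (sym (ℤ-Chains.*-distribˡ-sum {#E G} t _)) ⟨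
      sum (λ e → δ (dual P) h e * δ G g e + δ G g e * δ G g e) + sum (λ e → t * (φ e * δ G g e))
        ≡⟨ ℤ-Chains.∑-distrib-+ {#E G} _ _ ⟨
      sum (λ e → δ (dual P) h e * δ G g e + δ G g e * δ G g e + t * (φ e * δ G g e))
        ≡⟨ ℤ-Chains.sum-zero (λ e → trans (factor (δ (dual P) h e) (δ G g e) t (φ e)) (cong (_* δ G g e) (solves e))) ⟩
      0ℤ ∎
      where
      factor : ∀ a b t c → a * b + b * b + t * (c * b) ≡ (a + b + t * c) * b
      factor = solve-∀

    gradient-vanishes : ∀ e → δ G g e ≡ 0ℤ
    gradient-vanishes = sum-squares≡0 (δ G g) gradient-orthogonal

    potential-equation : ∀ e → δ (dual P) h e + t * φ e ≡ 0ℤ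
    potential-equation e = begin
      δ (dual P) h e + t * φ e                ≡⟨ cong (_+ t * φ e) (+-identityʳ (δ (dual P) h e)) ⟨
      δ (dual P) h e + 0ℤ + t * φ e           ≡⟨ cong (λ u → δ (dual P) h e + u + t * φ e) (gradient-vanishes e) ⟨
      δ (dual P) h e + δ G g e + t * φ e      ≡⟨ solves e ⟩
      0ℤ                                      ∎

    -- Connectedness is available for functions to `Bool`, so it is applied to the test whether `g`
    -- vanishes.
    vertex-part-trivial : ∀ r → g r ≡ 0ℤ → ∀ v → g v ≡ 0ℤ
    vertex-part-trivial r gr≡0 v with g v ≟ 0ℤ | locally-constant⇒constant fc (λ v → does (g v ≟ 0ℤ)) level r v
      where
      level : ∀ e → F₂.δ G (λ v → does (g v ≟ 0ℤ)) e ≡ false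
      level e = trans (cong (λ i → does (i ≟ 0ℤ) xor does (g (end G e false) ≟ 0ℤ)) (i-j≡0⇒i≡j (g (end G e true)) (g (end G e false)) (gradient-vanishes e)))
                      (Bool.xor-same (does (g (end G e false) ≟ 0ℤ)))
    ... | yes eq | _  = eq
    ... | no _   | eq = contradiction (trans (sym eq) (dec-true (g r ≟ 0ℤ) gr≡0)) λ ()

    face-part-trivial : t ≡ 0ℤ → ∀ o → h o ≡ 0ℤ → ∀ f → h f ≡ 0ℤ
    face-part-trivial t≡0 o ho≡0 f = trans (dual-connected P h level f o) ho≡0
      where
      level : ∀ e → h (left (e , true)) ≡ h (left (e , false))
      level e = i-j≡0⇒i≡j _ _ (begin
        δ (dual P) h e             ≡⟨ +-identityʳ (δ (dual P) h e) ⟨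
        δ (dual P) h e + 0ℤ * φ e  ≡⟨ cong (λ u → δ (dual P) h e + u * φ e) t≡0 ⟨
        δ (dual P) h e + t * φ e   ≡⟨ potential-equation e ⟩
        0ℤ                         ∎)

  Unknown : Set
  Unknown = Fin (#F ℕ.+ (#V G ℕ.+ 1))

  faceUnknown : Face → Unknown
  faceUnknown f = f ↑ˡ (#V G ℕ.+ 1)

  vertexUnknown : Vertex G → Unknown
  vertexUnknown v = #F ↑ʳ (v ↑ˡ 1)

  scaleUnknown : Unknown
  scaleUnknown = #F ↑ʳ (#V G ↑ʳ zero)

  unknown-cases : {Q : Unknown → Set} → (∀ f → Q (faceUnknown f)) → (∀ v → Q (vertexUnknown v)) →
                  Q scaleUnknown → ∀ j → Q j
  unknown-cases {Q} qf qv qs j = subst Q (join-splitAt #F _ j) (outer (splitAt #F j))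
    where
    inner : ∀ s → Q (#F ↑ʳ join (#V G) 1 s)
    inner (inj₁ v)    = qv v
    inner (inj₂ zero) = qs
    outer : ∀ s → Q (join #F _ s)
    outer (inj₁ f) = qf f
    outer (inj₂ k) = subst (Q ∘ (#F ↑ʳ_)) (join-splitAt (#V G) 1 k) (inner (splitAt (#V G) k))

  module _ (φ : Edge G → ℤ) where

    -- The first two equations fix the additive constants of `h` and `g`; constant functions would
    -- otherwise be nontrivial solutions with scale 0.
    equations : Fin (2 ℕ.+ #E G) → (Unknown → ℤ) → ℤ
    equations zero          x = x (faceUnknown (someFace P))
    equations (suc zero)    x = x (vertexUnknown (someVertex G))
    equations (suc (suc e)) x = δ (dual P) (x ∘ faceUnknown) e + δ G (x ∘ vertexUnknown) e + x scaleUnknown * φ e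

    equations-linear : ∀ i → IsLinear (equations i)
    equations-linear zero          a b x y z eq = eq _
    equations-linear (suc zero)    a b x y z eq = eq _
    equations-linear (suc (suc e)) =
      +-linear (+-linear (minus-linear (entry _) (entry _)) (minus-linear (entry _) (entry _)))
               (λ a b x y z eq → trans (cong (_* φ e) (eq _)) (regroup a b (x scaleUnknown) (y scaleUnknown) (φ e)))
      where
      entry : ∀ j → IsLinear (λ x → x j)
      entry j a b x y z eq = eq j
      regroup : ∀ a b p q c → (a * p + b * q) * c ≡ a * (p * c) + b * (q * c)
      regroup = solve-∀

  fewer-equations : 2 ℕ.+ #E G ℕ.< #F ℕ.+ (#V G ℕ.+ 1)
  fewer-equations = ℕ.≤-reflexive (sym (begin
    #F ℕ.+ (#V G ℕ.+ 1)   ≡⟨ ℕ.+-assoc #F (#V G) 1 ⟨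
    #F ℕ.+ #V G ℕ.+ 1     ≡⟨ ℕ.+-comm (#F ℕ.+ #V G) 1 ⟩
    suc (#F ℕ.+ #V G)     ≡⟨ cong suc (ℕ.+-comm #F (#V G)) ⟩
    suc (#V G ℕ.+ #F)     ≡⟨ cong suc (euler-connected fc P) ⟩
    suc (#E G ℕ.+ 2)      ≡⟨ cong suc (ℕ.+-comm (#E G) 2) ⟩
    suc (2 ℕ.+ #E G)      ∎))

  -- The E + 2 equations δh + δg + t φ = 0, h f₀ = 0, g r = 0 in the
  -- F + V + 1 = E + 3 unknowns h, g, t have a nontrivial solution; there
  -- δg = 0, because δg is orthogonal to δh, to φ and hence to itself.
  face-potential : ∀ {φ} → ℤ-Chains.IsCirculation G φ →
                   ∃[ h ] ∃[ t ] (t ≢ 0ℤ × (∀ e → δ (dual P) h e + t * φ e ≡ 0ℤ))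
  face-potential {φ} circ = fromSolution (nontrivial-solution fewer-equations (equations φ) (equations-linear φ))
    where
    fromSolution : Solution (equations φ) → ∃[ h ] ∃[ t ] (t ≢ 0ℤ × (∀ e → δ (dual P) h e + t * φ e ≡ 0ℤ))
    fromSolution (x , (j , xj≢0) , solves) =
      h , t , (λ t≡0 → xj≢0 (unknown-cases (face-part-trivial t≡0 (someFace P) (solves zero))
                                           (vertex-part-trivial (someVertex G) (solves (suc zero))) t≡0 j)) ,
      potential-equation
      where
      h = x ∘ faceUnknown
      t = x scaleUnknown
      open Potential φ circ h (x ∘ vertexUnknown) t (λ e → solves (suc (suc e)))

monotone⇒acyclic : (G : Graph) (ω : Orientation G) (h : Vertex G → ℤ) →
                   (∀ e → h (tail G ω e) < h (head G ω e)) → Acyclic G ω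
monotone⇒acyclic G ω h mono (v , ws , _ , cycle) = <-irrefl refl (ascent ws cycle)
  where
  ascent : ∀ {u v} ws → Linked (Arc G ω) (u ∷ ws ∷ʳ v) → h u < h v
  ascent []       ((e , refl , refl) ∷ [-])   = mono e
  ascent (_ ∷ ws) ((e , refl , refl) ∷ walk) = <-trans (mono e) (ascent ws walk)

-- Ears

∉∪ : ∀ {n} {p q : Subset n} {x} → x ∉ p → x ∉ q → x ∉ p ∪ q
∉∪ x∉p x∉q x∈ = [ x∉p , x∉q ]′ (x∈p∪q⁻ _ _ x∈)

∪-adjoin : ∀ {n} {p : Subset n} {x y} → y ∈ p ∪ ⁅ x ⁆ → y ∈ p ⊎ y ≡ x
∪-adjoin {x = x} y∈ with x∈p∪q⁻ _ _ y∈
... | inj₁ y∈p = inj₁ y∈p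
... | inj₂ y∈x = inj₂ (x∈⁅y⁆⇒x≡y x y∈x)

∈-adjoin : ∀ {n} (p : Subset n) x → x ∈ p ∪ ⁅ x ⁆
∈-adjoin p x = q⊆p∪q p ⁅ x ⁆ (x∈⁅x⁆ x)

sign : Bool → ℤ
sign true  = 1ℤ
sign false = -1ℤ

module _ {n} (P : Subset n) (τ : Fin n → Bool) where

  signed : Fin n → ℤ
  signed e = if lookup P e then sign (τ e) else 0ℤ

  signed-∈ : ∀ {e} → e ∈ P → signed e ≡ sign (τ e)
  signed-∈ {e} e∈P = cong (if_then sign (τ e) else 0ℤ) ([]=⇒lookup e∈P)

  signed-∉ : ∀ {e} → e ∉ P → signed e ≡ 0ℤ
  signed-∉ {e} e∉P = cong (if_then sign (τ e) else 0ℤ) (∉⇒lookup e∉P)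

module _ (G : Graph) where

  degree : (Edge G → Bool) → Vertex G → Bool
  degree z v = F₂.sum (λ e → z e ∧ F₂.δ G (λ u → indicator u v) e)

  -- A unit flow from `u` to `v`, in the dual form of `IsCirculation`. As a record it lets its
  -- indices be inferred.
  record IsFlow (u v : Vertex G) (p : Edge G → ℤ) : Set where
    constructor isFlow
    field
      divergence : ∀ g → ℤ-Chains.sum (λ e → p e * ℤ-Chains.δ G g e) ≡ g u - g v

  Mated : Subset (#E G) → Subset (#V G) → Set
  Mated M W = ∀ {e} → e ∈ M → ∀ b → end G e b ∈ W → end G e (not b) ∈ W

open IsFlow

module _ (G : Graph) where

  flow-trans : ∀ {u v w p q} → IsFlow G u v p → IsFlow G v w q → IsFlow G u w (λ e → p e + q e)
  flow-trans {u} {v} {w} {p} {q} fp fq = isFlow λ g → begin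
    ℤ-Chains.sum (λ e → (p e + q e) * ℤ-Chains.δ G g e)
      ≡⟨ ℤ-Chains.sum-cong-≗ {#E G} (λ e → *-distribʳ-+ (ℤ-Chains.δ G g e) (p e) (q e)) ⟩
    ℤ-Chains.sum (λ e → p e * ℤ-Chains.δ G g e + q e * ℤ-Chains.δ G g e)
      ≡⟨ ℤ-Chains.∑-distrib-+ {#E G} _ _ ⟩
    ℤ-Chains.sum (λ e → p e * ℤ-Chains.δ G g e) + ℤ-Chains.sum (λ e → q e * ℤ-Chains.δ G g e)
      ≡⟨ cong₂ _+_ (divergence fp g) (divergence fq g) ⟩
    (g u - g v) + (g v - g w)
      ≡⟨ telescope (g u) (g v) (g w) ⟩
    g u - g w ∎
    where
    telescope : ∀ a b c → (a - b) + (b - c) ≡ a - c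
    telescope = solve-∀

  flow-sym : ∀ {u v p} → IsFlow G u v p → IsFlow G v u (λ e → - p e)
  flow-sym {u} {v} {p} fp = isFlow λ g → begin
    ℤ-Chains.sum (λ e → - p e * ℤ-Chains.δ G g e)
      ≡⟨ ℤ-Chains.sum-cong-≗ {#E G} (λ e → pull (p e) (ℤ-Chains.δ G g e)) ⟩
    ℤ-Chains.sum (λ e → -1ℤ * (p e * ℤ-Chains.δ G g e))
      ≡⟨ ℤ-Chains.*-distribˡ-sum {#E G} -1ℤ _ ⟨
    -1ℤ * ℤ-Chains.sum (λ e → p e * ℤ-Chains.δ G g e)
      ≡⟨ cong (-1ℤ *_) (divergence fp g) ⟩
    -1ℤ * (g u - g v)
      ≡⟨ flip (g u) (g v) ⟩
    g v - g u ∎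
    where
    pull : ∀ a b → - a * b ≡ -1ℤ * (a * b)
    pull = solve-∀
    flip : ∀ a b → -1ℤ * (a - b) ≡ b - a
    flip = solve-∀

  flow-cong : ∀ {u v p q} → (∀ e → p e ≡ q e) → IsFlow G u v p → IsFlow G u v q
  flow-cong p≡q fp = isFlow λ g → trans (ℤ-Chains.sum-cong-≗ {#E G} (λ e → cong (_* ℤ-Chains.δ G g e) (sym (p≡q e)))) (divergence fp g)

  dart-flow : ∀ e b → IsFlow G (end G e b) (end G e (not b)) (signed ⁅ e ⁆ (λ _ → b))
  dart-flow e b = isFlow λ g → begin
    ℤ-Chains.sum (λ k → signed ⁅ e ⁆ (λ _ → b) k * ℤ-Chains.δ G g k)
      ≡⟨ ℤ-Chains.sum-single e (λ k k≢e → cong (_* ℤ-Chains.δ G g k) (signed-∉ ⁅ e ⁆ (λ _ → b) (x≢y⇒x∉⁅y⁆ k≢e))) ⟩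
    signed ⁅ e ⁆ (λ _ → b) e * ℤ-Chains.δ G g e
      ≡⟨ cong (_* ℤ-Chains.δ G g e) (signed-∈ ⁅ e ⁆ (λ _ → b) (x∈⁅x⁆ e)) ⟩
    sign b * ℤ-Chains.δ G g e
      ≡⟨ along g b ⟩
    g (end G e b) - g (end G e (not b)) ∎
    where
    flip : ∀ a b → -1ℤ * (a - b) ≡ b - a
    flip = solve-∀
    along : ∀ (g : Vertex G → ℤ) b → sign b * ℤ-Chains.δ G g e ≡ g (end G e b) - g (end G e (not b))
    along g true  = *-identityˡ _
    along g false = flip (g (end G e true)) (g (end G e false))

  sides : ∀ e b b′ → end G e b′ ≡ end G e b ⊎ end G e b′ ≡ end G e (not b)
  sides e true  true  = inj₁ refl
  sides e true  false = inj₂ refl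
  sides e false true  = inj₂ refl
  sides e false false = inj₁ refl

  incident-once : ∀ e b {v} → end G e b ≡ v → end G e (not b) ≢ v → F₂.δ G (λ u → indicator u v) e ≡ true
  incident-once e true  {v} at off = cong₂ _xor_ (dec-true (_ Fin.≟ v) at) (dec-false (_ Fin.≟ v) off)
  incident-once e false {v} at off = cong₂ _xor_ (dec-false (_ Fin.≟ v) off) (dec-true (_ Fin.≟ v) at)

  not-incident : ∀ e {v} → (∀ b → end G e b ≢ v) → F₂.δ G (λ u → indicator u v) e ≡ false
  not-incident e {v} off = cong₂ _xor_ (dec-false (_ Fin.≟ v) (off true)) (dec-false (_ Fin.≟ v) (off false))

-- The part covered by the ears so far. Its connectedness is kept as unit flows inside `A`, from
-- which the circuit through a new ear is later closed.
record IsRooted (G : Graph) (r : Vertex G) (H : Subset (#V G)) (A : Subset (#E G)) : Set where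
  field
    root   : r ∈ H
    inside : ∀ {e} → e ∈ A → ∀ b → end G e b ∈ H
    reach  : ∀ {v} → v ∈ H → ∃[ q ] (IsFlow G r v q × (∀ {e} → e ∉ A → q e ≡ 0ℤ))

module _ (G : Graph) (r : Vertex G) (H : Subset (#V G)) (A : Subset (#E G)) where

  -- P is the edge set of a path leaving H whose last dart is d, and W
  -- the set of vertices outside H that it visits before `target d`.
  -- All inner vertices have degree two in A ∪ P, hence `uniform`.
  record Path (P : Subset (#E G)) (W : Subset (#V G)) (d : Dart G) (odd : Bool) : Set where
    field
      last    : proj₁ d ∈ P
      from    : origin G d ∈ H ∪ W
      inner   : ∀ {e} → e ∈ P → e ≢ proj₁ d → ∀ b → end G e b ∈ H ∪ W
      fresh   : ∀ {e} → e ∈ P → e ∉ A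
      outside : ∀ {w} → w ∈ W → w ∉ H
      size    : F₂.sum (lookup P) ≡ odd
      τ       : Edge G → Bool
      flow    : ∃[ u ] (u ∈ H × IsFlow G u (target G d) (signed P τ))
      uniform : ∀ z → (∀ {w} → w ∈ W → degree G z w ≡ false) →
                (∀ {e} b → end G e b ∈ W → z e ≡ true → e ∈ P) →
                ∀ {e} → e ∈ P → z e ≡ z (proj₁ d)
      reached : ∀ {w} → w ∈ W → ∃[ q ] (IsFlow G r w q × (∀ {e} → e ∉ A → e ∉ P → q e ≡ 0ℤ))

  -- What the orientation uses of an ear. `closing` completes it to a circuit through `A`; `some` is
  -- a reference edge for the common value in `uniform`, which stems from the inner vertices having
  -- degree two.
  record Ear : Set where
    field
      {edges}   : Subset (#E G)
      {inners}  : Subset (#V G)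
      {some}    : Edge G
      some∈     : some ∈ edges
      fresh     : ∀ {e} → e ∈ edges → e ∉ A
      size      : F₂.sum (lookup edges) ≡ true
      direction : Edge G → Bool
      closing   : Edge G → ℤ
      closing-A : ∀ {e} → e ∉ A → closing e ≡ 0ℤ
      circuit   : ℤ-Chains.IsCirculation G (λ e → signed edges direction e + closing e)
      uniform   : ∀ z → F₂.IsCirculation G z → (∀ {e} → z e ≡ true → e ∈ A ⊎ e ∈ edges) →
                  ∀ {e} → e ∈ edges → z e ≡ z some
      rooted    : IsRooted G r (H ∪ inners) (A ∪ edges)

module _ {G : Graph} {r : Vertex G} {H : Subset (#V G)} {A : Subset (#E G)} (base : IsRooted G r H A) where
  open IsRooted base

  edge-path : ∀ d → origin G d ∈ H → proj₁ d ∉ A → Path G r H A ⁅ proj₁ d ⁆ ⊥ d true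
  edge-path d@(e , b) o∈H e∉A = record
    { last    = x∈⁅x⁆ e
    ; from    = p⊆p∪q ⊥ o∈H
    ; inner   = λ k∈ k≢e → contradiction (x∈⁅y⁆⇒x≡y e k∈) k≢e
    ; fresh   = λ k∈ → subst (_∉ A) (sym (x∈⁅y⁆⇒x≡y e k∈)) e∉A
    ; outside = λ w∈ → contradiction w∈ ∉⊥
    ; size    = trans (F₂.sum-single e λ k k≢e → ∉⇒lookup (x≢y⇒x∉⁅y⁆ k≢e)) ([]=⇒lookup (x∈⁅x⁆ e))
    ; τ       = λ _ → b
    ; flow    = end G e b , o∈H , dart-flow G e b
    ; uniform = λ z _ _ k∈ → cong z (x∈⁅y⁆⇒x≡y e k∈)
    ; reached = λ w∈ → contradiction w∈ ∉⊥
    }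

  reach-target : ∀ {P W d s} (path : Path G r H A P W d s) →
                 ∃[ q ] (IsFlow G r (target G d) q × (∀ {e} → e ∉ A → e ∉ P → q e ≡ 0ℤ))
  reach-target {P} path =
    let u , u∈H , fu = flow
        q , fq , q-A = reach u∈H
    in _ , flow-trans G fq fu , λ e∉A e∉P → cong₂ _+_ (q-A e∉A) (signed-∉ P τ e∉P)
    where open Path path

  module _ {P W d s} (path : Path G r H A P W d s) (k : Dart G) where
    open Path path

    -- The last two inequalities exclude that `k` is a loop or runs back along the last edge. Hence
    -- the new inner vertex `target G d` lies on exactly two edges of the longer path, once on each.
    extend : target G d ∉ H → target G d ∉ W → origin G k ≡ target G d →
             target G k ∉ W → target G k ≢ target G d → target G k ≢ origin G d →
             Path G r H A (P ∪ ⁅ proj₁ k ⁆) (W ∪ ⁅ target G d ⁆) k (not s)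
    extend x∉H x∉W k-at-x y∉W y≢x y≢o = record
      { last    = ∈-adjoin P l
      ; from    = q⊆p∪q H _ (subst (_∈ W ∪ ⁅ x ⁆) (sym k-at-x) (∈-adjoin W x))
      ; inner   = inner′
      ; fresh   = λ e∈ → [ fresh , (λ { refl e∈A → x∉H (subst (_∈ H) k-at-x (inside e∈A (proj₂ k))) }) ]′ (∪-adjoin e∈)
      ; outside = λ w∈ → [ outside , (λ { refl → x∉H }) ]′ (∪-adjoin w∈)
      ; size    = size′
      ; τ       = τ′
      ; flow    = let u , u∈H , fu = flow in
                  u , u∈H , flow-cong G (λ e → sym (signed-∪ e)) (flow-trans G fu (subst (λ v → IsFlow G v (target G k) (signed ⁅ l ⁆ (λ _ → proj₂ k))) k-at-x (dart-flow G l (proj₂ k))))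
      ; uniform = uniform′
      ; reached = reached′
      }
      where
      x = target G d
      l = proj₁ k

      grow : ∀ {v} → v ∈ H ∪ W → v ∈ H ∪ (W ∪ ⁅ x ⁆)
      grow v∈ = [ p⊆p∪q _ , (λ v∈W → q⊆p∪q H _ (p⊆p∪q ⁅ x ⁆ v∈W)) ]′ (x∈p∪q⁻ H W v∈)

      x∉H∪W : x ∉ H ∪ W
      x∉H∪W = ∉∪ x∉H x∉W

      o≢x : origin G d ≢ x
      o≢x eq = x∉H∪W (subst (_∈ H ∪ W) eq from)

      l≢d : l ≢ proj₁ d
      l≢d refl = [ y≢o , y≢x ]′ (sides G (proj₁ d) (proj₂ d) (not (proj₂ k)))

      l∉P : l ∉ P
      l∉P l∈P = x∉H∪W (subst (_∈ H ∪ W) k-at-x (inner l∈P l≢d (proj₂ k)))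

      inner′ : ∀ {e} → e ∈ P ∪ ⁅ l ⁆ → e ≢ l → ∀ b → end G e b ∈ H ∪ (W ∪ ⁅ x ⁆)
      inner′ {e} e∈ e≢l b with ∪-adjoin e∈
      ... | inj₂ e≡l = contradiction e≡l e≢l
      ... | inj₁ e∈P with e Fin.≟ proj₁ d
      ...   | no  e≢d  = grow (inner e∈P e≢d b)
      ...   | yes refl = [ (λ eq → subst (_∈ H ∪ (W ∪ ⁅ x ⁆)) (sym eq) (grow from))
                         , (λ eq → subst (_∈ H ∪ (W ∪ ⁅ x ⁆)) (sym eq) (q⊆p∪q H _ (∈-adjoin W x))) ]′
                         (sides G e (proj₂ d) b)

      lookup-∪ : ∀ e → lookup (P ∪ ⁅ l ⁆) e ≡ lookup P e xor lookup ⁅ l ⁆ e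
      lookup-∪ e with e Fin.≟ l
      ... | yes refl = trans ([]=⇒lookup (∈-adjoin P l)) (sym (cong₂ _xor_ (∉⇒lookup l∉P) ([]=⇒lookup (x∈⁅x⁆ l))))
      ... | no  e≢l  = trans (lookup-zipWith _ e P ⁅ l ⁆) (trans (cong (lookup P e ∨_) off)
                         (trans (Bool.∨-identityʳ _) (sym (trans (cong (lookup P e xor_) off) (Bool.xor-identityʳ _)))))
        where off = ∉⇒lookup (x≢y⇒x∉⁅y⁆ e≢l)

      size′ : F₂.sum (lookup (P ∪ ⁅ l ⁆)) ≡ not s
      size′ = begin
        F₂.sum (lookup (P ∪ ⁅ l ⁆))                      ≡⟨ F₂.sum-cong-≗ {#E G} lookup-∪ ⟩
        F₂.sum (λ e → lookup P e xor lookup ⁅ l ⁆ e)     ≡⟨ F₂.∑-distrib-+ {#E G} _ _ ⟩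
        F₂.sum (lookup P) xor F₂.sum (lookup ⁅ l ⁆)      ≡⟨ cong₂ _xor_ size (trans (F₂.sum-single l λ e e≢l → ∉⇒lookup (x≢y⇒x∉⁅y⁆ e≢l)) ([]=⇒lookup (x∈⁅x⁆ l))) ⟩
        s xor true                                       ≡⟨ Bool.xor-comm s true ⟩
        not s                                            ∎

      τ′ : Edge G → Bool
      τ′ e = if lookup P e then τ e else proj₂ k

      signed-∪ : ∀ e → signed (P ∪ ⁅ l ⁆) τ′ e ≡ signed P τ e + signed ⁅ l ⁆ (λ _ → proj₂ k) e
      signed-∪ e = trans (cong (if_then sign (τ′ e) else 0ℤ) (lookup-∪ e)) cases
        where
        cases : (if lookup P e xor lookup ⁅ l ⁆ e then sign (τ′ e) else 0ℤ) ≡ signed P τ e + signed ⁅ l ⁆ (λ _ → proj₂ k) e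
        cases with lookup P e in eqP | lookup ⁅ l ⁆ e in eql
        ... | false | false = refl
        ... | false | true  = sym (+-identityˡ _)
        ... | true  | false = sym (+-identityʳ _)
        ... | true  | true  = contradiction (subst (_∈ P) (x∈⁅y⁆⇒x≡y l (lookup⇒[]= e ⁅ l ⁆ eql)) (lookup⇒[]= e P eqP)) l∉P

      uniform′ : ∀ z → (∀ {w} → w ∈ W ∪ ⁅ x ⁆ → degree G z w ≡ false) →
                 (∀ {e} b → end G e b ∈ W ∪ ⁅ x ⁆ → z e ≡ true → e ∈ P ∪ ⁅ l ⁆) →
                 ∀ {e} → e ∈ P ∪ ⁅ l ⁆ → z e ≡ z l
      uniform′ z even support e∈ =
        [ (λ e∈P → trans (uniform z (λ w∈ → even (p⊆p∪q ⁅ x ⁆ w∈)) support′ e∈P) zd≡zl) , cong z ]′ (∪-adjoin e∈)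
        where
        off-W : ∀ b → end G l b ∉ W
        off-W b l∈W = [ (λ eq → x∉W (subst (_∈ W) (trans eq k-at-x) l∈W)) , (λ eq → y∉W (subst (_∈ W) eq l∈W)) ]′
                      (sides G l (proj₂ k) b)

        -- The new edge `l` has no end in `W`, so the enlarged support condition restricts to the
        -- old one.
        support′ : ∀ {e} b → end G e b ∈ W → z e ≡ true → e ∈ P
        support′ b e-W ze = [ (λ e∈P → e∈P) , (λ { refl → contradiction e-W (off-W b) }) ]′
                            (∪-adjoin (support b (p⊆p∪q ⁅ x ⁆ e-W) ze))

        others : ∀ e → e ≢ proj₁ d → e ≢ l → z e ∧ F₂.δ G (λ u → indicator u x) e ≡ false
        others e e≢d e≢l with z e in ze
        ... | false = refl
        ... | true  = not-incident G e λ b eq →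
              [ (λ e∈P → x∉H∪W (subst (_∈ H ∪ W) eq (inner e∈P e≢d b))) , e≢l ]′
              (∪-adjoin (support b (subst (_∈ W ∪ ⁅ x ⁆) (sym eq) (∈-adjoin W x)) ze))

        -- Only the old and the new last edge contribute to the degree of `z` at `x`; its evenness
        -- equates their values.
        zd≡zl : z (proj₁ d) ≡ z l
        zd≡zl = xor≡false⇒≡ (begin
          z (proj₁ d) xor z l
            ≡⟨ cong₂ _xor_ (Bool.∧-identityʳ (z (proj₁ d))) (Bool.∧-identityʳ (z l)) ⟨
          (z (proj₁ d) ∧ true) xor (z l ∧ true)
            ≡⟨ cong₂ (λ a b → (z (proj₁ d) ∧ a) xor (z l ∧ b))
                 (incident-once G (proj₁ d) (not (proj₂ d)) refl (λ eq → o≢x (trans (cong (end G (proj₁ d)) (sym (Bool.not-involutive (proj₂ d)))) eq)))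
                 (incident-once G l (proj₂ k) k-at-x y≢x) ⟨
          (z (proj₁ d) ∧ F₂.δ G (λ u → indicator u x) (proj₁ d)) xor (z l ∧ F₂.δ G (λ u → indicator u x) l)
            ≡⟨ F₂.sum-pair (l≢d ∘ sym) others ⟨
          degree G z x
            ≡⟨ even (∈-adjoin W x) ⟩
          false ∎)

      reached′ : ∀ {w} → w ∈ W ∪ ⁅ x ⁆ → ∃[ q ] (IsFlow G r w q × (∀ {e} → e ∉ A → e ∉ P ∪ ⁅ l ⁆ → q e ≡ 0ℤ))
      reached′ w∈ with ∪-adjoin w∈
      ... | inj₁ w∈W = let q , fq , q-AP = reached w∈W in q , fq , λ e∉A e∉P → q-AP e∉A (e∉P ∘ p⊆p∪q ⁅ l ⁆)
      ... | inj₂ refl = let q , fq , q-AP = reach-target path in q , fq , λ e∉A e∉P → q-AP e∉A (e∉P ∘ p⊆p∪q ⁅ l ⁆)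

  -- The circuit follows the path from `u` to `target G d` and returns to `u` inside `A` by way of
  -- the root. For `uniform`, evenness at `W` is the circulation property tested on indicators, and
  -- edges of `A` avoid `W` because `W` is outside `H`.
  close : ∀ {P W d} → Path G r H A P W d true → target G d ∈ H → Ear G r H A
  close {P} {W} {d} path x∈H = record
    { edges = P; inners = W; some = proj₁ d
    ; some∈     = last
    ; fresh     = fresh
    ; size      = size
    ; direction = τ
    ; closing   = closing
    ; closing-A = λ e∉A → cong₂ (λ a b → - a + b) (proj₂ (proj₂ reach-x) e∉A) (proj₂ (proj₂ reach-u) e∉A)
    ; circuit   = λ g → trans (divergence (flow-trans G (proj₂ (proj₂ flow)) (flow-trans G (flow-sym G (proj₁ (proj₂ reach-x))) (proj₁ (proj₂ reach-u)))) g)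
                              (+-inverseʳ (g u))
    ; uniform   = λ z circ support → uniform z (λ {w} _ → circ (λ v → indicator v w))
                    (λ {e} b e-W ze → [ (λ e∈A → contradiction (inside e∈A b) (outside e-W)) , (λ e∈P → e∈P) ]′ (support ze))
    ; rooted    = record
      { root   = p⊆p∪q W root
      ; inside = λ e∈ b → [ (λ e∈A → p⊆p∪q W (inside e∈A b)) , (λ e∈P → inside-P e∈P b) ]′ (x∈p∪q⁻ A P e∈)
      ; reach  = λ v∈ → reach′ (x∈p∪q⁻ H W v∈)
      }
    }
    where
    open Path path
    u = proj₁ flow
    reach-u = reach (proj₁ (proj₂ flow))
    reach-x = reach x∈H

    closing : Edge G → ℤ
    closing e = - proj₁ reach-x e + proj₁ reach-u e

    inside-P : ∀ {e} → e ∈ P → ∀ b → end G e b ∈ H ∪ W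
    inside-P {e} e∈P b with e Fin.≟ proj₁ d
    ... | no  e≢d  = inner e∈P e≢d b
    ... | yes refl = [ (λ eq → subst (_∈ H ∪ W) (sym eq) from) , (λ eq → subst (_∈ H ∪ W) (sym eq) (p⊆p∪q W x∈H)) ]′
                     (sides G e (proj₂ d) b)

    reach′ : ∀ {v} → v ∈ H ⊎ v ∈ W → ∃[ q ] (IsFlow G r v q × (∀ {e} → e ∉ A ∪ P → q e ≡ 0ℤ))
    reach′ (inj₁ v∈H) = let q , fq , q-A = reach v∈H in q , fq , λ e∉ → q-A (e∉ ∘ p⊆p∪q P)
    reach′ (inj₂ v∈W) = let q , fq , q-AP = reached v∈W in q , fq , λ e∉ → q-AP (e∉ ∘ p⊆p∪q P) (e∉ ∘ q⊆p∪q A P)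

-- Growing odd ears by alternating between two matchings

module _ {G : Graph} {r M} (isM : IsPerfectMatchingOn G (⊤ ∖ r) M) where
  open IsPerfectMatchingOn isM

  matched-avoids : ∀ {e} → e ∈ M → ∀ b → end G e b ≢ r
  matched-avoids e∈M b refl = x∉p∖x ⊤ r (inside e∈M b)

  matched-dart : ∀ {v} → v ≢ r → ∃[ d ] (proj₁ d ∈ M × origin G d ≡ v)
  matched-dart v≢r with covers (x∈p∧x≢y⇒x∈p-y ∈⊤ v≢r)
  ... | e , (e∈M , (b , eq)) , _ = (e , b) , e∈M , eq

  target≢origin : ∀ d → proj₁ d ∈ M → target G d ≢ origin G d
  target≢origin (e , true)  e∈M eq = loopless e∈M (sym eq)
  target≢origin (e , false) e∈M eq = loopless e∈M eq

  mate-unique : ∀ d → proj₁ d ∈ M → ∀ {e} → e ∈ M → ∀ b → end G e b ≡ origin G d → end G e (not b) ≡ target G d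
  mate-unique d@(k , b′) k∈M {e} e∈M b eq with covers (x∈p∧x≢y⇒x∈p-y ∈⊤ (matched-avoids k∈M b′))
  ... | m , _ , unique with trans (sym (unique (e∈M , b , eq))) (unique (k∈M , b′ , refl))
  ...   | refl with b Bool.≟ b′
  ...     | yes refl = refl
  ...     | no  b≢b′ = contradiction (trans (cong (end G k) (sym (Bool.¬-not b≢b′))) eq) (target≢origin (k , b′) k∈M)

Mated-∪ : ∀ G {M U W} → Mated G M U → Mated G M W → Mated G M (U ∪ W)
Mated-∪ G {U = U} {W} mU mW e∈M b v∈ =
  [ (λ v∈U → p⊆p∪q W (mU e∈M b v∈U)) , (λ v∈W → q⊆p∪q U W (mW e∈M b v∈W)) ]′ (x∈p∪q⁻ U W v∈)

module _ {G : Graph} {r M} (isM : IsPerfectMatchingOn G (⊤ ∖ r) M) where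

  mated-pair : ∀ {W} d → proj₁ d ∈ M → Mated G M W → Mated G M ((W ∪ ⁅ origin G d ⁆) ∪ ⁅ target G d ⁆)
  mated-pair {W} d d∈M mW {e} e∈M b v∈ with ∪-adjoin v∈
  ... | inj₂ eq = p⊆p∪q _ (subst (_∈ W ∪ ⁅ origin G d ⁆)
                    (sym (trans (mate-unique isM (reverse G d) d∈M e∈M b eq) (cong (origin G) (reverse-involutive G d)))) (∈-adjoin W _))
  ... | inj₁ v∈W∪o with ∪-adjoin v∈W∪o
  ...   | inj₂ eq  = subst (_∈ (W ∪ ⁅ origin G d ⁆) ∪ ⁅ target G d ⁆) (sym (mate-unique isM d d∈M e∈M b eq)) (∈-adjoin _ _)
  ...   | inj₁ v∈W = p⊆p∪q _ (p⊆p∪q _ (mW e∈M b v∈W))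

module _ {G : Graph} {r : Vertex G} {H : Subset (#V G)} {A : Subset (#E G)} (base : IsRooted G r H A)
         {M} (isM : IsPerfectMatchingOn G (⊤ ∖ r) M) (mated-H : Mated G M H)
         {v N} (isN : IsPerfectMatchingOn G (⊤ ∖ v) N) where
  open IsRooted base

  -- Closure under the fixed matching `M` is the invariant from ear to ear: an `M`-edge that starts
  -- outside `H` never enters it.
  MatedEar : Set
  MatedEar = ∃[ ear ] Mated G M (H ∪ Ear.inners {G} {r} {H} {A} ear)

  -- The path follows an M-edge x y and then an N-edge y x′.  Neither y
  -- nor x′ was visited before, since W is closed under M and W ∪ {x}
  -- under N, so the process ends, and it can only end in H.
  alternate : ∀ {P W d} → Acc _⊃_ W → Path G r H A P W d true →
              target G d ∉ H → target G d ∉ W → v ∈ W ∪ ⁅ target G d ⁆ →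
              Mated G M W → Mated G N (W ∪ ⁅ target G d ⁆) → MatedEar
  alternate {P} {W} {d} (acc rec) path x∉H x∉W v∈ mated-W mated-N
    with matched-dart isM {target G d} (λ { eq → x∉H (subst (_∈ H) (sym eq) root) })
  ... | m , m∈M , m-at-x
    -- `N` misses only `v`, which lies in the set `W ∪ ⁅ x ⁆` that the end of the `M`-edge avoids.
    with matched-dart isN {target G m} (λ { refl → y∉W∪x v∈ })
    where
    x = target G d
    y∉W∪x : target G m ∉ W ∪ ⁅ x ⁆
    y∉W∪x y∈ with ∪-adjoin y∈
    ... | inj₂ y≡x = target≢origin isM m m∈M (trans y≡x (sym m-at-x))
    ... | inj₁ y∈W = x∉W (subst (_∈ W) (trans (cong (origin G) (reverse-involutive G m)) m-at-x) (mated-W m∈M (not (proj₂ m)) y∈W))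
  ... | n , n∈N , n-at-y = result
    where
    x  = target G d
    y  = target G m
    x′ = target G n
    W′ = (W ∪ ⁅ x ⁆) ∪ ⁅ y ⁆

    x≡x : end G (proj₁ m) (not (not (proj₂ m))) ≡ x
    x≡x = trans (cong (origin G) (reverse-involutive G m)) m-at-x

    y∉W : y ∉ W
    y∉W y∈W = x∉W (subst (_∈ W) x≡x (mated-W m∈M (not (proj₂ m)) y∈W))

    y∉H : y ∉ H
    y∉H y∈H = x∉H (subst (_∈ H) x≡x (mated-H m∈M (not (proj₂ m)) y∈H))

    y≢x : y ≢ x
    y≢x eq = target≢origin isM m m∈M (trans eq (sym m-at-x))

    y∉W∪x : y ∉ W ∪ ⁅ x ⁆
    y∉W∪x y∈ = [ y∉W , y≢x ]′ (∪-adjoin y∈)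

    x′∉W∪x : x′ ∉ W ∪ ⁅ x ⁆
    x′∉W∪x x′∈ = y∉W∪x (subst (_∈ W ∪ ⁅ x ⁆) (trans (cong (origin G) (reverse-involutive G n)) n-at-y) (mated-N n∈N (not (proj₂ n)) x′∈))

    x′≢y : x′ ≢ y
    x′≢y eq = target≢origin isN n n∈N (trans eq (sym n-at-y))

    path₁ : Path G r H A (P ∪ ⁅ proj₁ m ⁆) (W ∪ ⁅ x ⁆) m false
    path₁ = extend base path m x∉H x∉W m-at-x y∉W y≢x
              (λ y≡o → ∉∪ y∉H y∉W (subst (_∈ H ∪ W) (sym y≡o) (Path.from path)))

    path₂ : Path G r H A ((P ∪ ⁅ proj₁ m ⁆) ∪ ⁅ proj₁ n ⁆) W′ n true
    path₂ = extend base path₁ n y∉H y∉W∪x n-at-y x′∉W∪x x′≢y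
              (λ x′≡o → x′∉W∪x (subst (_∈ W ∪ ⁅ x ⁆) (sym (trans x′≡o m-at-x)) (∈-adjoin W x)))

    mated-W′ : Mated G M W′
    mated-W′ = subst (λ o → Mated G M ((W ∪ ⁅ o ⁆) ∪ ⁅ y ⁆)) m-at-x (mated-pair isM m m∈M mated-W)

    mated-N′ : Mated G N (W′ ∪ ⁅ x′ ⁆)
    mated-N′ = subst (λ o → Mated G N (((W ∪ ⁅ x ⁆) ∪ ⁅ o ⁆) ∪ ⁅ x′ ⁆)) n-at-y (mated-pair isN n n∈N mated-N)

    x′∉W′ : x′ ∉ W′
    x′∉W′ x′∈ = [ x′∉W∪x , x′≢y ]′ (∪-adjoin x′∈)

    result : MatedEar
    -- Only an `N`-edge can return to `H`, and after it the path has odd length.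
    result with x′ ∈? H
    ... | yes x′∈H = close base path₂ x′∈H , Mated-∪ G mated-H mated-W′
    ... | no  x′∉H = alternate (rec ((λ w∈ → p⊆p∪q ⁅ y ⁆ (p⊆p∪q ⁅ x ⁆ w∈)) , x , p⊆p∪q ⁅ y ⁆ (∈-adjoin W x) , x∉W))
                       path₂ x′∉H x′∉W′ (p⊆p∪q ⁅ x′ ⁆ (p⊆p∪q ⁅ y ⁆ v∈)) mated-W′ mated-N′

module _ {G : Graph} (fc : FactorCritical G)
         {r : Vertex G} {H : Subset (#V G)} {A : Subset (#E G)} (base : IsRooted G r H A)
         {M} (isM : IsPerfectMatchingOn G (⊤ ∖ r) M) (mated-H : Mated G M H) where

  -- An edge with both ends in `H`, possibly a loop, is an ear by itself. Otherwise `N` is the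
  -- matching that misses the first vertex outside `H`, so this vertex alone is a set closed under
  -- `N` and the alternation can start.
  ear-through : ∀ d → origin G d ∈ H → proj₁ d ∉ A → ∃[ ear ] Mated G M (H ∪ Ear.inners {G} {r} {H} {A} ear)
  ear-through d o∈H d∉A with target G d ∈? H
  ... | yes t∈H = close base (edge-path base d o∈H d∉A) t∈H , Mated-∪ G mated-H (λ _ _ v∈⊥ → contradiction v∈⊥ ∉⊥)
  ... | no  t∉H = alternate base isM mated-H isN (⊃-wellFounded ⊥) (edge-path base d o∈H d∉A) t∉H ∉⊥ (∈-adjoin ⊥ _)
                    (λ _ _ v∈⊥ → contradiction v∈⊥ ∉⊥)
                    (λ e∈N b v∈ → [ (λ v∈⊥ → contradiction v∈⊥ ∉⊥) , (λ eq → contradiction eq (matched-avoids isN e∈N b)) ]′ (∪-adjoin v∈))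
    where isN = proj₂ (fc (target G d))

-- Orienting the dual along an odd ear decomposition

xor-interchange : ∀ a b c d → (a xor b) xor (c xor d) ≡ (a xor c) xor (b xor d)
xor-interchange false b c d = trans (sym (Bool.xor-assoc b c d)) (trans (cong (_xor d) (Bool.xor-comm b c)) (Bool.xor-assoc c b d))
xor-interchange true  b c d = trans (sym (Bool.not-distribˡ-xor b (c xor d)))
  (trans (cong not (xor-interchange false b c d)) (Bool.not-distribˡ-xor c (b xor d)))

-- A positive integer is at least 1, so the factor `1ℤ + B` leaves at least 1 after a loss of `B`.
dominated : ∀ {u w B} → 0ℤ < u → - B ≤ w → 0ℤ ≤ B → 0ℤ < (1ℤ + B) * u + w
dominated {u} {w} {+ b} 0<u -B≤w _ = <-≤-trans (subst (0ℤ <_) (sym (one (+ b))) (+<+ (ℕ.s≤s ℕ.z≤n)))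
  (+-mono-≤ (*-monoˡ-≤-nonNeg (1ℤ + + b) (i<j⇒suc[i]≤j 0<u)) -B≤w)
  where
  one : ∀ B → (1ℤ + B) * 1ℤ + - B ≡ 1ℤ
  one = solve-∀

-∣i∣≤i : ∀ i → - + ∣ i ∣ ≤ i
-∣i∣≤i (+ zero)   = ≤-refl
-∣i∣≤i (+ suc n)  = ℤ.-≤+
  where open import Data.Integer as ℤ using ()
-∣i∣≤i -[1+ n ]   = ≤-refl

∣sign*i∣ : ∀ b i → ∣ sign b * i ∣ ≡ ∣ i ∣
∣sign*i∣ true  i = cong ∣_∣ (*-identityˡ i)
∣sign*i∣ false i = trans (cong ∣_∣ (-1*i≡-i i)) (∣-i∣≡∣i∣ i)

0<i*j : ∀ {i j} → 0ℤ < i → 0ℤ < j → 0ℤ < i * j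
0<i*j {+ suc m} {+ suc n} _         _ = +<+ (ℕ.s≤s ℕ.z≤n)
0<i*j {+ zero}  {_}       (+<+ ())  _
0<i*j {+ suc m} {+ zero}  _         (+<+ ())

0<i*i : ∀ i → i ≢ 0ℤ → 0ℤ < i * i
0<i*i (+ zero)  i≢0 = contradiction refl i≢0
0<i*i (+ suc n) _   = +<+ (ℕ.s≤s ℕ.z≤n)
0<i*i -[1+ n ]  _   = +<+ (ℕ.s≤s ℕ.z≤n)

module _ {G : Graph} (P : PlanarEmbedding G) where
  open PlanarEmbedding P

  δ* : (Face → Bool) → Edge G → Bool
  δ* = F₂.δ (dual P)

  -- The total indegree of the faces in `S`, modulo 2.
  heads : Orientation (dual P) → (Face → Bool) → Bool
  heads ω S = F₂.sum (λ e → S (left (e , not (ω e))))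

  -- Vanishes on the indicator of a face f iff the indegree of f has the
  -- required parity: even at `someFace P`, odd elsewhere.
  defect : Orientation (dual P) → (Face → Bool) → Bool
  defect ω S = heads ω S xor (F₂.sum S xor S (someFace P))

  SupportedOn : Subset (#E G) → (Face → Bool) → Set
  SupportedOn A S = ∀ e → e ∉ A → δ* S e ≡ false

  -- Interpolates between the start and the goal: for `⊥` only constant `S` qualify, for `⊤` all of
  -- them, in particular single faces.
  Balanced : Subset (#E G) → Orientation (dual P) → Set
  Balanced A ω = ∀ S → SupportedOn A S → defect ω S ≡ false

  defect-xor : ∀ ω S T → defect ω (λ f → S f xor T f) ≡ defect ω S xor defect ω T
  defect-xor ω S T = begin
    heads ω (λ f → S f xor T f) xor (F₂.sum (λ f → S f xor T f) xor (S o xor T o))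
      ≡⟨ cong₂ (λ a b → a xor (b xor (S o xor T o))) (F₂.∑-distrib-+ {#E G} _ _) (F₂.∑-distrib-+ {#F} S T) ⟩
    (heads ω S xor heads ω T) xor ((F₂.sum S xor F₂.sum T) xor (S o xor T o))
      ≡⟨ cong ((heads ω S xor heads ω T) xor_) (xor-interchange (F₂.sum S) (F₂.sum T) (S o) (T o)) ⟩
    (heads ω S xor heads ω T) xor ((F₂.sum S xor S o) xor (F₂.sum T xor T o))
      ≡⟨ xor-interchange (heads ω S) (heads ω T) _ _ ⟩
    defect ω S xor defect ω T ∎
    where o = someFace P

  defect-cong : ∀ ω {S T} → (∀ f → S f ≡ T f) → defect ω S ≡ defect ω T
  defect-cong ω S≡T = cong₂ _xor_ (F₂.sum-cong-≗ {#E G} λ e → S≡T _) (cong₂ _xor_ (F₂.sum-cong-≗ {#F} S≡T) (S≡T _))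

  -- An edge with both or neither of its sides in `S` contributes the same in either direction.
  defect-agree : ∀ {ω ω′} S → (∀ e → ω e ≡ ω′ e ⊎ δ* S e ≡ false) → defect ω S ≡ defect ω′ S
  defect-agree {ω} {ω′} S agree = cong (_xor (F₂.sum S xor S (someFace P))) (F₂.sum-cong-≗ {#E G} λ e → same e (agree e))
    where
    same : ∀ e → ω e ≡ ω′ e ⊎ δ* S e ≡ false → S (left (e , not (ω e))) ≡ S (left (e , not (ω′ e)))
    same e (inj₁ eq)   = cong (λ b → S (left (e , not b))) eq
    same e (inj₂ flat) = trans (both (not (ω e))) (sym (both (not (ω′ e))))
      where
      both : ∀ b → S (left (e , b)) ≡ S (left (e , false))
      both true  = xor≡false⇒≡ flat
      both false = refl

  -- An empty boundary makes `S` constant. For the set of all faces every edge is counted, so the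
  -- defect is E + F + 1 modulo 2.
  balanced-⊥ : FactorCritical G → ∀ ω → Balanced ⊥ ω
  balanced-⊥ fc ω S support = trans (defect-cong ω {S} {λ _ → S (someFace P)} λ f → dual-connected P S (λ e → xor≡false⇒≡ (support e ∉⊥)) f _)
    (constant (S (someFace P)))
    where
    constant : ∀ a → defect ω (λ _ → a) ≡ false
    constant false = cong₂ _xor_ (F₂.sum-zero {#E G} λ _ → refl) (cong (_xor false) (F₂.sum-zero {#F} λ _ → refl))
    constant true  = begin
      parity (#E G) xor (parity #F xor true)    ≡⟨ cong₂ _xor_ (face-parity fc P) (Bool.xor-comm (parity #F) true) ⟩
      not (parity #F) xor not (parity #F)       ≡⟨ Bool.xor-same (not (parity #F)) ⟩
      false                                     ∎

  supportedOn? : ∀ A S → Dec (SupportedOn A S)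
  supportedOn? A S = all? λ e → ¬? (e ∈? A) →-dec (δ* S e Bool.≟ false)

  module EarStep {r H A} (ear : Ear G r H A) (ω : Orientation (dual P)) (balanced : Balanced A ω) where
    open Ear ear

    reorient : Bool → Orientation (dual P)
    reorient flip e = if lookup edges e then direction e xor flip else ω e

    reorient-∈ : ∀ flip {e} → e ∈ edges → reorient flip e ≡ direction e xor flip
    reorient-∈ flip {e} e∈ = cong (if_then direction e xor flip else ω e) ([]=⇒lookup e∈)

    reorient-∉ : ∀ flip {e} → e ∉ edges → reorient flip e ≡ ω e
    reorient-∉ flip {e} e∉ = cong (if_then direction e xor flip else ω e) (∉⇒lookup e∉)

    module _ {S} (support : SupportedOn (A ∪ edges) S) where

      uniform* : ∀ {e} → e ∈ edges → δ* S e ≡ δ* S some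
      uniform* = uniform (δ* S) (F₂.δ-dual-circulation P S) λ {e} eq → x∈p∪q⁻ A edges
        (decidable-stable (e ∈? A ∪ edges) λ e∉ → contradiction (trans (sym eq) (support e e∉)) λ ())

      -- Such an `S` has its boundary in `A` already and does not see the direction of the ear, so
      -- the old balance applies.
      flat-on-ear : δ* S some ≡ false → ∀ flip → defect (reorient flip) S ≡ false
      flat-on-ear flat flip = trans (defect-agree S agree) (balanced S support′)
        where
        agree : ∀ e → reorient flip e ≡ ω e ⊎ δ* S e ≡ false
        agree e with e ∈? edges
        ... | yes e∈ = inj₂ (trans (uniform* e∈) flat)
        ... | no  e∉ = inj₁ (reorient-∉ flip e∉)
        support′ : SupportedOn A S
        support′ e e∉A with e ∈? edges
        ... | yes e∈ = trans (uniform* e∈) flat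
        ... | no  e∉ = support e (∉∪ e∉A e∉)

      -- Every ear edge has exactly one side in `S`, so reversing it moves its head into or out of
      -- `S`; this happens an odd number of times.
      steep-on-ear : δ* S some ≡ true → defect (reorient true) S ≡ not (defect (reorient false) S)
      steep-on-ear steep = begin
        heads (reorient true) S xor c
          ≡⟨ cong (_xor c) (trans (F₂.sum-cong-≗ {#E G} flipped) (F₂.∑-distrib-+ {#E G} _ _)) ⟩
        (F₂.sum (lookup edges) xor heads (reorient false) S) xor c
          ≡⟨ cong (λ s → (s xor heads (reorient false) S) xor c) size ⟩
        not (heads (reorient false) S) xor c
          ≡⟨ Bool.not-distribˡ-xor (heads (reorient false) S) c ⟨
        not (defect (reorient false) S) ∎
        where
        c = F₂.sum S xor S (someFace P)

        step : ∀ e d → δ* S e ≡ true →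
               S (left (e , not (d xor true))) ≡ true xor S (left (e , not (d xor false)))
        step e d jump with d
        ... | true  = opposite (S (left (e , true))) _ jump
          where
          opposite : ∀ a b → a xor b ≡ true → a ≡ not b
          opposite true  false _ = refl
          opposite false true  _ = refl
        ... | false = opposite (S (left (e , true))) _ jump
          where
          opposite : ∀ a b → a xor b ≡ true → b ≡ not a
          opposite true  false _ = refl
          opposite false true  _ = refl

        flipped : ∀ e → S (left (e , not (reorient true e))) ≡ lookup edges e xor S (left (e , not (reorient false e)))
        flipped e with lookup edges e in eq
        ... | false = refl
        ... | true  = step e (direction e) (trans (uniform* (lookup⇒[]= e edges eq)) steep)

    -- If one direction of the ear fails at S₀, then it fails at every S
    -- whose boundary contains the ear, because S + S₀ is flat on it; as
    -- the ear is odd, the other direction then works for all of them.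
    choose : ∃[ flip ] Balanced (A ∪ edges) (reorient flip)
    -- A failing set is sought among the finitely many `Subset` vectors, which keeps the choice
    -- constructive.
    choose with anySubset? (λ s → supportedOn? (A ∪ edges) (lookup s) ×-dec (defect (reorient false) (lookup s) Bool.≟ true))
    ... | no none = false , λ S support → Bool.¬-not λ bad → none (tabulate S ,
            (λ e e∉ → trans (cong₂ _xor_ (lookup∘tabulate S _) (lookup∘tabulate S _)) (support e e∉)) ,
            trans (defect-cong (reorient false) (lookup∘tabulate S)) bad)
    ... | yes (s , support₀ , bad) = true , works
      where
      S₀ = lookup s

      steep₀ : δ* S₀ some ≡ true
      steep₀ with δ* S₀ some in eq
      ... | true  = refl
      ... | false = contradiction (trans (sym bad) (flat-on-ear support₀ eq false)) λ ()

      works : Balanced (A ∪ edges) (reorient true)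
      works S support with δ* S some in eq
      ... | false = flat-on-ear support eq true
      ... | true  = trans (steep-on-ear support eq) (cong not (trans (xor≡false⇒≡ (trans (sym (defect-xor (reorient false) S S₀))
                      (flat-on-ear {λ f → S f xor S₀ f} support⁺ (trans (δ*-xor some) (cong₂ _xor_ eq steep₀)) false))) bad))
        where
        δ*-xor : ∀ e → δ* (λ f → S f xor S₀ f) e ≡ δ* S e xor δ* S₀ e
        δ*-xor e = xor-interchange (S (left (e , true))) (S₀ (left (e , true))) (S (left (e , false))) (S₀ (left (e , false)))
        support⁺ : SupportedOn (A ∪ edges) (λ f → S f xor S₀ f)
        support⁺ e e∉ = trans (δ*-xor e) (cong₂ _xor_ (support e e∉) (support₀ e e∉))

  record Oriented (A : Subset (#E G)) : Set where
    field
      ω        : Orientation (dual P)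
      φ        : Edge G → ℤ
      circ     : ℤ-Chains.IsCirculation G φ
      positive : ∀ {e} → e ∈ A → 0ℤ < sign (ω e) * φ e
      vanish   : ∀ {e} → e ∉ A → φ e ≡ 0ℤ
      balanced : Balanced A ω

  module _ {r H A} (oriented : Oriented A) (ear : Ear G r H A) where
    open Oriented oriented
    open Ear ear
    open EarStep ear ω balanced

    bound : ℤ
    bound = ℤ-Chains.sum (λ e → + ∣ closing e ∣)

    circuit-flow : Edge G → ℤ
    circuit-flow e = signed edges direction e + closing e

    -- On `A` the old flow scaled by `1ℤ + bound` outweighs `closing`, each value of which is at
    -- most `bound` in absolute value. On the ear the old flow and `closing` vanish, so the signed
    -- ear alone determines the sign.
    add-ear : Oriented (A ∪ edges)
    add-ear = record
      { ω = reorient flip ; φ = φ′ ; circ = circ′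
      ; positive = λ e∈ → positive′ (x∈p∪q⁻ A edges e∈)
      ; vanish = λ {e} e∉ → zero-flow (vanish (e∉ ∘ p⊆p∪q edges))
                   (cong₂ _+_ (signed-∉ edges direction (e∉ ∘ q⊆p∪q A edges)) (closing-A (e∉ ∘ p⊆p∪q edges)))
      ; balanced = proj₂ choose
      }
      where
      flip = proj₁ choose
      -- With `flip` true the ear runs against `direction`, so its circuit is added with sign -1.
      σ = sign (not flip)

      φ′ : Edge G → ℤ
      φ′ e = (1ℤ + bound) * φ e + σ * circuit-flow e

      zero-flow : ∀ {a c} → a ≡ 0ℤ → c ≡ 0ℤ → (1ℤ + bound) * a + σ * c ≡ 0ℤ
      zero-flow refl refl = cong₂ _+_ (*-zeroʳ (1ℤ + bound)) (*-zeroʳ σ)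

      circ′ : ℤ-Chains.IsCirculation G φ′
      circ′ g = begin
        ℤ-Chains.sum (λ e → φ′ e * ℤ-Chains.δ G g e)
          ≡⟨ ℤ-Chains.sum-cong-≗ {#E G} (λ e → expand (1ℤ + bound) (φ e) σ (circuit-flow e) (ℤ-Chains.δ G g e)) ⟩
        ℤ-Chains.sum (λ e → (1ℤ + bound) * (φ e * ℤ-Chains.δ G g e) + σ * (circuit-flow e * ℤ-Chains.δ G g e))
          ≡⟨ ℤ-Chains.∑-distrib-+ {#E G} _ _ ⟩
        ℤ-Chains.sum (λ e → (1ℤ + bound) * (φ e * ℤ-Chains.δ G g e)) + ℤ-Chains.sum (λ e → σ * (circuit-flow e * ℤ-Chains.δ G g e))
          ≡⟨ cong₂ _+_ (ℤ-Chains.*-distribˡ-sum {#E G} (1ℤ + bound) _) (ℤ-Chains.*-distribˡ-sum {#E G} σ _) ⟨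
        (1ℤ + bound) * ℤ-Chains.sum (λ e → φ e * ℤ-Chains.δ G g e) + σ * ℤ-Chains.sum (λ e → circuit-flow e * ℤ-Chains.δ G g e)
          ≡⟨ zero-flow (circ g) (circuit g) ⟩
        0ℤ ∎
        where
        expand : ∀ k a s c d → (k * a + s * c) * d ≡ k * (a * d) + s * (c * d)
        expand = solve-∀

      positive′ : ∀ {e} → e ∈ A ⊎ e ∈ edges → 0ℤ < sign (reorient flip e) * φ′ e
      positive′ {e} (inj₁ e∈A) = subst (0ℤ <_) (sym (begin
          sign (reorient flip e) * φ′ e
            ≡⟨ cong₂ (λ b c → sign b * ((1ℤ + bound) * φ e + σ * c)) (reorient-∉ flip e∉)
                 (trans (cong (_+ closing e) (signed-∉ edges direction e∉)) (+-identityˡ (closing e))) ⟩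
          sign (ω e) * ((1ℤ + bound) * φ e + σ * closing e)
            ≡⟨ regroup (sign (ω e)) (1ℤ + bound) (φ e) (σ * closing e) ⟩
          (1ℤ + bound) * (sign (ω e) * φ e) + sign (ω e) * (σ * closing e) ∎))
        (dominated {B = bound} (positive e∈A) (≤-trans (neg-mono-≤ small) (-∣i∣≤i _)) (nonneg-sum {#E G} λ _ → +≤+ ℕ.z≤n))
        where
        e∉ : e ∉ edges
        e∉ e∈ = fresh e∈ e∈A
        small : + ∣ sign (ω e) * (σ * closing e) ∣ ≤ bound
        small = subst (λ n → + n ≤ bound) (sym (trans (∣sign*i∣ (ω e) (σ * closing e)) (∣sign*i∣ (not flip) (closing e))))
                  (term≤sum {#E G} {λ e → + ∣ closing e ∣} (λ _ → +≤+ ℕ.z≤n) e)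
        regroup : ∀ s k a c → s * (k * a + c) ≡ k * (s * a) + s * c
        regroup = solve-∀
      positive′ {e} (inj₂ e∈) = subst (0ℤ <_) (sym (begin
          sign (reorient flip e) * φ′ e
            ≡⟨ cong₂ (λ b c → sign b * ((1ℤ + bound) * φ e + σ * c)) (reorient-∈ flip e∈)
                 (trans (cong₂ _+_ (signed-∈ edges direction e∈) (closing-A (fresh e∈))) (+-identityʳ _)) ⟩
          sign (direction e xor flip) * ((1ℤ + bound) * φ e + σ * sign (direction e))
            ≡⟨ cong (λ a → sign (direction e xor flip) * (a + σ * sign (direction e)))
                 (trans (cong ((1ℤ + bound) *_) (vanish (fresh e∈))) (*-zeroʳ (1ℤ + bound))) ⟩
          sign (direction e xor flip) * (0ℤ + σ * sign (direction e))
            ≡⟨ unit-sign (direction e) flip ⟩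
          1ℤ ∎)) (+<+ (ℕ.s≤s ℕ.z≤n))
        where
        unit-sign : ∀ d f → sign (d xor f) * (0ℤ + sign (not f) * sign d) ≡ 1ℤ
        unit-sign true  true  = refl
        unit-sign true  false = refl
        unit-sign false true  = refl
        unit-sign false false = refl

  -- Exhausting the graph by ears and reading off the orientation

  module _ (fc : FactorCritical G) where

    private
      r = someVertex G
      M = proj₁ (fc r)
      isM = proj₂ (fc r)

    -- Each ear enlarges `A`. Once no edge outside `A` meets `H`, membership in `H` is constant
    -- along edges; by connectedness `H` then contains every vertex, and `A` every edge.
    grow : ∀ {H A} → Acc _⊃_ A → IsRooted G r H A → Mated G M H → Oriented A → Oriented ⊤
    grow {H} {A} (acc rec) base mated oriented
      with any? (λ e → ¬? (e ∈? A) ×-dec ((end G e true ∈? H) ⊎-dec (end G e false ∈? H)))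
    ... | yes (e , e∉A , at) = continue (ear-through fc base isM mated (proj₁ dart) (proj₁ (proj₂ dart)) (proj₂ (proj₂ dart)))
      where
      dart : ∃[ d ] (origin G d ∈ H × proj₁ d ∉ A)
      dart = [ (λ at → (e , true) , at , e∉A) , (λ at → (e , false) , at , e∉A) ]′ at
      continue : ∃[ ear ] Mated G M (H ∪ Ear.inners {G} {r} {H} {A} ear) → Oriented ⊤
      continue (ear , mated′) = grow (rec (p⊆p∪q edges , some , q⊆p∪q A edges some∈ , fresh some∈)) rooted mated′ (add-ear oriented ear)
        where open Ear ear
    ... | no none = subst Oriented (⊆-antisym ⊆⊤ (λ {e} _ → all-edges e)) oriented
      where
      open IsRooted base

      absorbed : ∀ e b → end G e b ∈ H → e ∈ A
      absorbed e b at = decidable-stable (e ∈? A) λ e∉A → none (e , e∉A , side b at)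
        where
        side : ∀ b → end G e b ∈ H → end G e true ∈ H ⊎ end G e false ∈ H
        side true  = inj₁
        side false = inj₂

      level : ∀ e → F₂.δ G (lookup H) e ≡ false
      level e with end G e true ∈? H | end G e false ∈? H
      ... | yes t∈ | _      = cong₂ _xor_ ([]=⇒lookup t∈) ([]=⇒lookup (inside (absorbed e true t∈) false))
      ... | no  _  | yes f∈ = cong₂ _xor_ ([]=⇒lookup (inside (absorbed e false f∈) true)) ([]=⇒lookup f∈)
      ... | no  t∉ | no f∉  = cong₂ _xor_ (∉⇒lookup t∉) (∉⇒lookup f∉)

      all-edges : ∀ e → e ∈ A
      all-edges e = absorbed e true (lookup⇒[]= (end G e true) H
        (trans (locally-constant⇒constant fc (lookup H) level (end G e true) r) ([]=⇒lookup root)))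

    fully-oriented : Oriented ⊤
    fully-oriented = grow {⁅ r ⁆} {⊥} (⊃-wellFounded ⊥)
      (record
        { root   = x∈⁅x⁆ r
        ; inside = λ e∈⊥ → contradiction e∈⊥ ∉⊥
        ; reach  = λ v∈ → (λ _ → 0ℤ) , isFlow (λ g → trans (ℤ-Chains.sum-zero {#E G} λ e → refl)
                     (sym (subst (λ v → g r + - g v ≡ 0ℤ) (sym (x∈⁅y⁆⇒x≡y r v∈)) (+-inverseʳ (g r))))) , λ _ → refl
        })
      (λ e∈M b at → contradiction (x∈⁅y⁆⇒x≡y r at) (matched-avoids isM e∈M b))
      (record
        { ω = λ _ → true ; φ = λ _ → 0ℤ
        ; circ     = λ g → ℤ-Chains.sum-zero {#E G} λ e → refl
        ; positive = λ e∈⊥ → contradiction e∈⊥ ∉⊥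
        ; vanish   = λ _ → refl
        ; balanced = balanced-⊥ fc (λ _ → true)
        })

    module _ (oriented : Oriented ⊤) where
      open Oriented oriented

      -- The sign of `t` is unknown, so `t * h` serves as the height: its rise along an arc carries
      -- the factor `t * t`, which is positive.
      potential⇒acyclic : ∀ h t → t ≢ 0ℤ → (∀ e → ℤ-Chains.δ (dual P) h e + t * φ e ≡ 0ℤ) → Acyclic (dual P) ω
      potential⇒acyclic h t t≢0 eq = monotone⇒acyclic (dual P) ω (λ f → t * h f) λ e →
          0<i-j⇒j<i (subst (0ℤ <_) (sym (rise e)) (0<i*j (0<i*i t t≢0) (positive ∈⊤)))
        where
        0<i-j⇒j<i : ∀ {i j} → 0ℤ < i + - j → j < i
        0<i-j⇒j<i {i} {j} lt = subst₂ _<_ (+-identityˡ j) (cancel i j) (+-monoˡ-< j lt)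
          where
          cancel : ∀ i j → i + - j + j ≡ i
          cancel = solve-∀

        rise : ∀ e → t * h (head (dual P) ω e) + - (t * h (tail (dual P) ω e)) ≡ t * t * (sign (ω e) * φ e)
        rise e = trans (jump (ω e)) (trans (cong (λ d → t * (sign (ω e) * d)) drop) (regroup t (sign (ω e)) (φ e)))
          where
          drop : - ℤ-Chains.δ (dual P) h e ≡ t * φ e
          drop = trans (move _ (t * φ e)) (trans (cong (λ z → - z + t * φ e) (eq e)) (+-identityˡ _))
            where
            move : ∀ a b → - a ≡ - (a + b) + b
            move = solve-∀
          jump : ∀ b → t * h (left (e , not b)) + - (t * h (left (e , b))) ≡ t * (sign b * - ℤ-Chains.δ (dual P) h e)
          jump true  = up t (h (left (e , true))) (h (left (e , false)))
            where
            up : ∀ t a b → t * b + - (t * a) ≡ t * (1ℤ * - (a + - b))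
            up = solve-∀
          jump false = down t (h (left (e , true))) (h (left (e , false)))
            where
            down : ∀ t a b → t * a + - (t * b) ≡ t * (-1ℤ * - (a + - b))
            down = solve-∀
          regroup : ∀ t s a → t * (s * (t * a)) ≡ t * t * (s * a)
          regroup = solve-∀

      oriented⇒acyclic : Acyclic (dual P) ω
      oriented⇒acyclic =
        let h , t , t≢0 , eq = face-potential fc P circ
        in potential⇒acyclic h t t≢0 eq

      -- The balance condition for the single face `f`, whose boundary lies in `⊤` trivially.
      indegree-parity : ∀ f → parity (indegree (dual P) ω f) ≡ not (indicator (someFace P) f)
      indegree-parity f = trans (parity-filter (λ e → head (dual P) ω e Fin.≟ f) id)
        (trans (xor≡false⇒≡ (balanced S (λ e e∉ → contradiction ∈⊤ e∉)))
               (cong (_xor indicator (someFace P) f) (trans (F₂.sum-single f λ g g≢f → dec-false (g Fin.≟ f) g≢f) (dec-true (f Fin.≟ f) refl))))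
        where
        S : Face → Bool
        S g = indicator g f

      oriented⇒dualCritical : DualCritical (dual P)
      oriented⇒dualCritical = ω , oriented⇒acyclic , o , even-o , odd
        where
        o = someFace P

        even-o : ¬ OddIndegree (dual P) ω o
        even-o odd = odd (parity≡false⇒even _ (trans (indegree-parity o) (cong not (dec-true (o Fin.≟ o) refl))))

        odd : ∀ f → f ≢ o → OddIndegree (dual P) ω f
        odd f f≢o even = contradiction (trans (sym (even⇒parity≡false even))
          (trans (indegree-parity f) (cong not (dec-false (o Fin.≟ f) (f≢o ∘ sym))))) λ ()

theorem12 : (G : Graph) → Planar G → FactorCritical G →
    (P : PlanarEmbedding G) → DualCritical (dual P)
theorem12 G _ fc P = oriented⇒dualCritical P fc (fully-oriented P fc)
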